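{- Let $n,m,l$ be positive integers with $m<\frac{n}{2}$, $l\geq n+1$, and $l$ an odd prime. If there exists a binary linear code with parameters $[n+1,k,\geq 8m]$ contained in the binary $[n+1,n,2]$ even-weight code, then there exists a lattice of rank $n$ (in ${\bf R}^{n+1}$) with center density at least $\frac{2^{k-\frac{n}{2}}\cdot m^{n/2}}{l^{m-1}(n+1)^{1/2}}$.
   Context: A binary linear $[N,k,d]$ code is a $k$-dimensional subspace of ${\bf F}_2^N$ whose nonzero vectors all have Hamming weight at least $d$; the $[n+1,n,2]$ code is the set of vectors in ${\bf F}_2^{n+1}$ of even weight. For a lattice ${\bf L}$ of rank $r$ with shortest nonzero vector length $\lambda$ and volume $\mathrm{Vol}({\bf L})$ (square root of the Gram determinant of a basis), the center density is $(\lambda/2)^r/\mathrm{Vol}({\bf L})$. -}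

module Defs where

open import Data.Bool using (Bool; true; false; _xor_; _∧_)
open import Data.Nat using (ℕ; zero; suc)
import Data.Nat as ℕ
open import Data.Integer using (ℤ; +_; _+_; _*_; -_; 0ℤ; 1ℤ)
open import Data.Fin using (Fin; toℕ)
open import Relation.Binary.PropositionalEquality using (_≢_)
open import Data.Vec using (Vec; []; _∷_; map; zipWith; replicate; foldr; tabulate; lookup; removeAt; allFin)

weight : ∀ {N} → Vec Bool N → ℕ
weight []          = 0
weight (true ∷ w)  = suc (weight w)
weight (false ∷ w) = weight w

zeroWord : ∀ {N} → Vec Bool N
zeroWord = replicate _ false

combine : ∀ {N k} → Vec (Vec Bool N) k → Vec Bool k → Vec Bool N
combine []       []       = zeroWord
combine (g ∷ gs) (c ∷ cs) = zipWith _xor_ (map (c ∧_) g) (combine gs cs)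

data Even : ℕ → Set where
  even0  : Even 0
  even+2 : ∀ {n} → Even n → Even (suc (suc n))

-- The F_2-span of the k rows of G is a binary linear [N,k,≥d] code
-- contained in the [N,N-1,2] even-weight code:
--   * rows linearly independent (span has dimension k),
--   * every nonzero codeword has weight ≥ d,
--   * every codeword has even weight.
record EvenSubcode (N k d : ℕ) (G : Vec (Vec Bool N) k) : Set where
  field
    independent : ∀ c → c ≢ zeroWord → combine G c ≢ zeroWord
    minDist     : ∀ c → combine G c ≢ zeroWord → d ℕ.≤ weight (combine G c)
    evenWeight  : ∀ c → Even (weight (combine G c))

sumℤ : ∀ {n} → Vec ℤ n → ℤ
sumℤ = foldr _ _+_ 0ℤ

dot : ∀ {N} → Vec ℤ N → Vec ℤ N → ℤ
dot u v = sumℤ (zipWith _*_ u v)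

latticeVec : ∀ {N r} → Vec (Vec ℤ N) r → Vec ℤ r → Vec ℤ N
latticeVec []       []       = replicate _ 0ℤ
latticeVec (b ∷ bs) (a ∷ as) = zipWith _+_ (map (a *_) b) (latticeVec bs as)

gram : ∀ {N r} → Vec (Vec ℤ N) r → Vec (Vec ℤ r) r
gram B = map (λ u → map (dot u) B) B

sign : ℕ → ℤ
sign zero          = 1ℤ
sign (suc zero)    = - 1ℤ
sign (suc (suc n)) = sign n

det : ∀ {n} → Vec (Vec ℤ n) n → ℤ
det {zero}  []         = 1ℤ
det {suc n} (r ∷ rows) =
  sumℤ (tabulate (λ (j : Fin (suc n)) →
          sign (toℕ j) * (lookup r j * det (map (λ row → removeAt row j) rows))))

{-# OPTIONS --safe #-}
module Submission where

-- The lattice consists of the v in the root lattice A_n whose coordinates satisfy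
-- Σ i^j v_i ≡ 0 (mod l) for 1 ≤ j < m and whose reduction modulo 2 lies in the code.
--
-- Norm: if the reduction is a nonzero codeword, then |v|² is at least its weight, hence ≥ 8m.
-- Otherwise v = 2y, where y satisfies the same congruences modulo l because l is odd.  Were
-- |y|² < 2m, the positive and the negative parts of y would be two disjoint multisets of the same
-- size s < m whose power sums agree modulo l; by Newton's identities they would be the roots of
-- the same polynomial modulo l, which is impossible as the n + 1 indices are distinct modulo l.
-- So |v|² = 4|y|² ≥ 8m.
--
-- Volume: A_n has Gram determinant n + 1, and each of the m − 1 congruences modulo l and n − k
-- parity checks multiplies it by at most l² and 4 respectively.  One check fewer than the
-- codimension of the code suffices, since v has even coordinate sum and the code is even.

open import Defs
open import Data.Bool using (Bool; true; false; _xor_; _∧_; not)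
open import Data.Bool.Properties using (∧-zeroʳ; xor-identityʳ)
import Data.Bool.Properties as Boolₚ
open import Data.Bool.Solver using (module xor-∧-Solver)
open import Data.Empty using (⊥; ⊥-elim)
open import Data.Fin using (Fin; toℕ; fromℕ<)
import Data.Fin as Fin
import Data.Fin.Properties as Finₚ
open import Data.Integer using (ℤ; +_; -[1+_]; _+_; _*_; _-_; -_; 0ℤ; 1ℤ; ∣_∣; +≤+; +<+; _^_)
import Data.Integer as ℤ
open import Data.Integer.Divisibility.Signed using (_∣_; divides; _∣?_; ∣ᵤ⇒∣; ∣⇒∣ᵤ)
open import Data.Integer.Divisibility.Signed using (∣m∣n⇒∣m+n; ∣m∣n⇒∣m-n; ∣n⇒∣m*n; ∣m⇒∣m*n; ∣m⇒∣-m)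
import Data.Integer.Properties as ℤₚ
open import Data.Integer.Tactic.RingSolver using (solve-∀)
open import Data.List using (List; []; _∷_; _++_; length)
import Data.List as List
open import Data.List.Membership.Propositional using (_∈_)
open import Data.List.Membership.Propositional.Properties using (∈-++⁻)
open import Data.List.Relation.Unary.Any using (here; there)
open import Data.Nat using (ℕ; zero; suc; s≤s; z≤n; _≤_; _<_; _%_)
import Data.Nat as ℕ
open import Data.Nat.Coprimality using (Coprime; coprime-Bézout)
import Data.Nat.Divisibility as ℕ∣
open import Data.Nat.GCD using (module Bézout)
open import Data.Nat.Primality using (Prime; prime[2]; prime⇒irreducible; prime⇒nonZero)
import Data.Nat.Properties as ℕₚ
open import Data.Product using (Σ; ∃; _×_; _,_; proj₁; proj₂)
open import Data.Sum using (inj₁; inj₂)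
open import Data.Vec using (Vec; []; _∷_; map; zipWith; replicate; tabulate; lookup; removeAt; toList)
import Data.Vec.Properties as Vecₚ
open import Data.Vec.Relation.Unary.All as All using (All; []; _∷_)
open import Data.Vec.Relation.Unary.All.Properties using (map⁻; tabulate⁻)
open import Relation.Binary.PropositionalEquality
open import Relation.Nullary using (¬_; yes; no)


-- Powers of integers and the density estimate

*-nonNeg : ∀ {a b} → 0ℤ ℤ.≤ a → 0ℤ ℤ.≤ b → 0ℤ ℤ.≤ a * b
*-nonNeg {a} {b} 0≤a 0≤b = subst (ℤ._≤ a * b) (ℤₚ.*-zeroʳ a) (ℤₚ.*-monoˡ-≤-nonNeg a {{ℤ.nonNegative 0≤a}} 0≤b)

^-nonNeg : ∀ {a} n → 0ℤ ℤ.≤ a → 0ℤ ℤ.≤ a ^ n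
^-nonNeg zero    0≤a = +≤+ z≤n
^-nonNeg (suc n) 0≤a = *-nonNeg 0≤a (^-nonNeg n 0≤a)

^-monoˡ-≤ : ∀ n {a b} → 0ℤ ℤ.≤ a → a ℤ.≤ b → a ^ n ℤ.≤ b ^ n
^-monoˡ-≤ zero    0≤a a≤b = ℤₚ.≤-refl
^-monoˡ-≤ (suc n) {a} {b} 0≤a a≤b = ℤₚ.≤-trans
  (ℤₚ.*-monoʳ-≤-nonNeg (a ^ n) {{ℤ.nonNegative (^-nonNeg n 0≤a)}} a≤b)
  (ℤₚ.*-monoˡ-≤-nonNeg b {{ℤ.nonNegative (ℤₚ.≤-trans 0≤a a≤b)}} (^-monoˡ-≤ n 0≤a a≤b))

^-distribʳ-* : ∀ n a b → (a * b) ^ n ≡ a ^ n * b ^ n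
^-distribʳ-* zero    a b = refl
^-distribʳ-* (suc n) a b = trans (cong (a * b *_) (^-distribʳ-* n a b)) (lemma a b (a ^ n) (b ^ n))
  where
  lemma : ∀ a b c d → a * b * (c * d) ≡ a * c * (b * d)
  lemma = solve-∀

^-square : ∀ i n → i ^ (2 ℕ.* n) ≡ (i * i) ^ n
^-square i n = trans (ℤₚ.^-distribˡ-+-* i n (n ℕ.+ 0))
  (trans (cong (λ j → i ^ n * i ^ j) (ℕₚ.+-identityʳ n)) (sym (^-distribʳ-* n i i)))

-- Here `s` is the squared index, `s * + suc n` the Gram determinant and `X` a norm. The bound on
-- `s` and the `n`-th power of 8m ≤ `X` are the only estimates; the powers of two then match, since
-- r + k = n gives 4^r 4^k 4^n m^n = 16^n m^n = (8m)^n 2^n.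
density-inequality : ∀ n k r μ l m s X → r ℕ.+ k ≡ n → s ℤ.≤ (+ 2 * + 2) ^ r * (+ l * + l) ^ μ →
  + (8 ℕ.* m) ℤ.≤ X →
  (+ 2) ^ (2 ℕ.* k) * (+ m) ^ n * (+ 4) ^ n * (s * + suc n)
    ℤ.≤ X ^ n * (+ l) ^ (2 ℕ.* μ) * + suc n * (+ 2) ^ n
density-inequality n k r μ l m s X r+k≡n s≤ 8m≤X = begin
  (+ 2) ^ (2 ℕ.* k) * (+ m) ^ n * (+ 4) ^ n * (s * + suc n)
    ≤⟨ ℤₚ.*-monoˡ-≤-nonNeg c {{ℤ.nonNegative 0≤c}} (ℤₚ.*-monoʳ-≤-nonNeg (+ suc n) s≤) ⟩
  (+ 2) ^ (2 ℕ.* k) * (+ m) ^ n * (+ 4) ^ n * ((+ 4) ^ r * L * + suc n)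
    ≡⟨ cong (λ z → z * (+ m) ^ n * (+ 4) ^ n * ((+ 4) ^ r * L * + suc n)) (^-square (+ 2) k) ⟩
  (+ 4) ^ k * (+ m) ^ n * (+ 4) ^ n * ((+ 4) ^ r * L * + suc n)
    ≡⟨ lemma₁ ((+ 4) ^ k) ((+ m) ^ n) ((+ 4) ^ n) ((+ 4) ^ r) L (+ suc n) ⟩
  (+ 4) ^ r * (+ 4) ^ k * (+ 4) ^ n * (+ m) ^ n * (L * + suc n)
    ≡⟨ cong (λ z → z * (L * + suc n)) powers≡ ⟩
  (+ (8 ℕ.* m)) ^ n * (+ 2) ^ n * (L * + suc n)
    ≤⟨ ℤₚ.*-monoʳ-≤-nonNeg (L * + suc n) {{ℤ.nonNegative (*-nonNeg 0≤L (+≤+ z≤n))}}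
         (ℤₚ.*-monoʳ-≤-nonNeg ((+ 2) ^ n) {{ℤ.nonNegative (^-nonNeg {+ 2} n (+≤+ z≤n))}} (^-monoˡ-≤ n (+≤+ z≤n) 8m≤X)) ⟩
  X ^ n * (+ 2) ^ n * (L * + suc n)
    ≡⟨ lemma₂ (X ^ n) ((+ 2) ^ n) L (+ suc n) ⟩
  X ^ n * L * + suc n * (+ 2) ^ n
    ≡⟨ cong (λ z → X ^ n * z * + suc n * (+ 2) ^ n) (^-square (+ l) μ) ⟨
  X ^ n * (+ l) ^ (2 ℕ.* μ) * + suc n * (+ 2) ^ n ∎
  where
  open ℤₚ.≤-Reasoning
  c L : ℤ
  c = (+ 2) ^ (2 ℕ.* k) * (+ m) ^ n * (+ 4) ^ n
  L = (+ l * + l) ^ μ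
  0≤c : 0ℤ ℤ.≤ c
  0≤c = *-nonNeg (*-nonNeg (^-nonNeg {+ 2} (2 ℕ.* k) (+≤+ z≤n)) (^-nonNeg {+ m} n (+≤+ z≤n))) (^-nonNeg {+ 4} n (+≤+ z≤n))
  0≤L : 0ℤ ℤ.≤ L
  0≤L = ^-nonNeg μ (*-nonNeg {+ l} {+ l} (+≤+ z≤n) (+≤+ z≤n))
  lemma₁ : ∀ a b c d e f → a * b * c * (d * e * f) ≡ d * a * c * b * (e * f)
  lemma₁ = solve-∀
  lemma₂ : ∀ a b c d → a * b * (c * d) ≡ a * c * d * b
  lemma₂ = solve-∀
  lemma₃ : ∀ z → + 4 * + 4 * z ≡ + 8 * z * + 2
  lemma₃ = solve-∀
  powers≡ : (+ 4) ^ r * (+ 4) ^ k * (+ 4) ^ n * (+ m) ^ n ≡ (+ (8 ℕ.* m)) ^ n * (+ 2) ^ n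
  powers≡ = begin-equality
    (+ 4) ^ r * (+ 4) ^ k * (+ 4) ^ n * (+ m) ^ n
      ≡⟨ cong (λ z → z * (+ 4) ^ n * (+ m) ^ n) (trans (sym (ℤₚ.^-distribˡ-+-* (+ 4) r k)) (cong ((+ 4) ^_) r+k≡n)) ⟩
    (+ 4) ^ n * (+ 4) ^ n * (+ m) ^ n
      ≡⟨ trans (cong (_* (+ m) ^ n) (sym (^-distribʳ-* n (+ 4) (+ 4)))) (sym (^-distribʳ-* n (+ 4 * + 4) (+ m))) ⟩
    (+ 4 * + 4 * + m) ^ n
      ≡⟨ cong (_^ n) (trans (lemma₃ (+ m)) (cong (_* + 2) (sym (ℤₚ.pos-* 8 m)))) ⟩
    (+ (8 ℕ.* m) * + 2) ^ n
      ≡⟨ ^-distribʳ-* n (+ (8 ℕ.* m)) (+ 2) ⟩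
    (+ (8 ℕ.* m)) ^ n * (+ 2) ^ n ∎

open ≡-Reasoning
open xor-∧-Solver using (solve; _:+_; _:*_; _:=_)

-- Gram determinants

Lattice : ℕ → Set
Lattice N = List (Vec ℤ N)

lin : ∀ {N} → ℤ → Vec ℤ N → ℤ → Vec ℤ N → Vec ℤ N
lin α x β y = zipWith _+_ (map (α *_) x) (map (β *_) y)

dot-comm : ∀ {N} (u v : Vec ℤ N) → dot u v ≡ dot v u
dot-comm []      []      = refl
dot-comm (a ∷ u) (b ∷ v) = cong₂ _+_ (ℤₚ.*-comm a b) (dot-comm u v)

dot-lin : ∀ {N} (u : Vec ℤ N) α x β y → dot u (lin α x β y) ≡ α * dot u x + β * dot u y
dot-lin []      α []      β []      = sym (cong₂ _+_ (ℤₚ.*-zeroʳ α) (ℤₚ.*-zeroʳ β))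
dot-lin (a ∷ u) α (x ∷ xs) β (y ∷ ys) = trans (cong (_+_ (a * (α * x + β * y))) (dot-lin u α xs β ys))
  (lemma a α x β y (dot u xs) (dot u ys))
  where
  lemma : ∀ a α x β y s t → a * (α * x + β * y) + (α * s + β * t) ≡ α * (a * x + s) + β * (a * y + t)
  lemma = solve-∀

-- Alternating sum over the entries c of C of f c times H of the list without c: Laplace
-- expansion of a determinant whose first row is f and whose minors are given by H.
expand : ∀ {A : Set} → (A → ℤ) → (List A → ℤ) → List A → ℤ
expand f H []       = 0ℤ
expand f H (c ∷ cs) = f c * H cs - expand f (λ ds → H (c ∷ ds)) cs

-- The determinant of the matrix of products of `B` with `C`, zero when the lengths differ. Rows and
-- columns are separate lists, so that minors are again of this form and a basis can be changed on
-- one side at a time.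
gramDet : ∀ {N} → Lattice N → Lattice N → ℤ
gramDet []       []      = 1ℤ
gramDet []       (_ ∷ _) = 0ℤ
gramDet (b ∷ bs) C       = expand (dot b) (gramDet bs) C

-- The minors in an expansion of `C` are one entry shorter than `C`; the length condition supplies
-- the bound for the induction in `gramDet-sym≤`.
expand-cong : ∀ {A : Set} (f : A → ℤ) {H K} C → (∀ ds → suc (length ds) ≡ length C → H ds ≡ K ds) →
              expand f H C ≡ expand f K C
expand-cong f []       eq = refl
expand-cong f (c ∷ cs) eq =
  cong₂ (λ s t → f c * s - t) (eq cs refl) (expand-cong f cs (λ ds p → eq (c ∷ ds) (cong suc p)))

expand-linear : ∀ {A : Set} (f : A → ℤ) α β {H K L : List A → ℤ} C →
                (∀ ds → H ds ≡ α * K ds + β * L ds) → expand f H C ≡ α * expand f K C + β * expand f L C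
expand-linear f α β []       eq = sym (cong₂ _+_ (ℤₚ.*-zeroʳ α) (ℤₚ.*-zeroʳ β))
expand-linear f α β {H} {K} {L} (c ∷ cs) eq =
  trans (cong₂ (λ s t → f c * s - t) (eq cs) (expand-linear f α β cs (λ ds → eq (c ∷ ds))))
        (lemma (f c) α β (K cs) (L cs) _ _)
  where
  lemma : ∀ u α β k l s t → u * (α * k + β * l) - (α * s + β * t) ≡ α * (u * k - s) + β * (u * l - t)
  lemma = solve-∀

expand-zero : ∀ {A : Set} (f : A → ℤ) C → expand f (λ _ → 0ℤ) C ≡ 0ℤ
expand-zero f []       = refl
expand-zero f (c ∷ cs) = cong₂ _-_ (ℤₚ.*-zeroʳ (f c)) (expand-zero f cs)

-- A Fubini rule: `expand g` is linear in the function of minors, so it absorbs the outer expansion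
-- term by term.
expand-swap : ∀ {A B : Set} (f : A → ℤ) (g : B → ℤ) (K : List A → List B → ℤ) D E →
              expand f (λ ds → expand g (K ds) E) D ≡ expand g (λ es → expand f (λ ds → K ds es) D) E
expand-swap f g K []       E = sym (expand-zero g E)
expand-swap f g K (d ∷ ds) E = begin
  f d * expand g (K ds) E - expand f (λ xs → expand g (K (d ∷ xs)) E) ds
    ≡⟨ cong (λ z → f d * expand g (K ds) E - z) (expand-swap f g (λ xs → K (d ∷ xs)) ds E) ⟩
  f d * expand g (K ds) E - expand g (λ es → expand f (λ xs → K (d ∷ xs) es) ds) E
    ≡⟨ minus (f d) _ _ ⟩
  f d * expand g (K ds) E + - 1ℤ * expand g (λ es → expand f (λ xs → K (d ∷ xs) es) ds) E
    ≡⟨ expand-linear g (f d) (- 1ℤ) E (λ es → minus (f d) _ _) ⟨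
  expand g (λ es → f d * K ds es - expand f (λ xs → K (d ∷ xs) es) ds) E ∎
  where
  minus : ∀ u s t → u * s - t ≡ u * s + - 1ℤ * t
  minus = solve-∀

-- Apart from the corner term, expand along the first row and then each minor along its first
-- column; `expand-swap` interchanges the two. The hypothesis is applied to lists such as `b ∷ es`
-- that are not structural parts of the arguments, hence the induction on the length bound `n`.
gramDet-sym≤ : ∀ {N} n (B C : Lattice N) → length B ℕ.≤ n → gramDet B C ≡ gramDet C B
gramDet-sym≤ n       []       []       p = refl
gramDet-sym≤ n       []       (c ∷ cs) p = refl
gramDet-sym≤ n       (b ∷ bs) []       p = refl
gramDet-sym≤ (suc n) (b ∷ bs) (c ∷ cs) (ℕ.s≤s p) =
  cong₂ _-_ (cong₂ _*_ (dot-comm b c) (gramDet-sym≤ n bs cs p)) (begin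
    expand (dot b) (λ ds → gramDet bs (c ∷ ds)) cs
      ≡⟨ expand-cong (dot b) cs (λ ds _ → gramDet-sym≤ n bs (c ∷ ds) p) ⟩
    expand (dot b) (λ ds → expand (dot c) (gramDet ds) bs) cs
      ≡⟨ expand-swap (dot b) (dot c) gramDet cs bs ⟩
    expand (dot c) (λ es → expand (dot b) (λ ds → gramDet ds es) cs) bs
      ≡⟨ expand-cong (dot c) bs (λ es q → expand-cong (dot b) cs (λ ds _ →
           sym (gramDet-sym≤ n es ds (ℕₚ.≤-trans (ℕₚ.≤-trans (ℕₚ.n≤1+n _) (ℕₚ.≤-reflexive q)) p)))) ⟩
    expand (dot c) (λ es → gramDet (b ∷ es) cs) bs
      ≡⟨ expand-cong (dot c) bs (λ es q → gramDet-sym≤ n (b ∷ es) cs (ℕₚ.≤-trans (ℕₚ.≤-reflexive q) p)) ⟩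
    expand (dot c) (λ es → gramDet cs (b ∷ es)) bs ∎)

gramDet-sym : ∀ {N} (B C : Lattice N) → gramDet B C ≡ gramDet C B
gramDet-sym B C = gramDet-sym≤ (length B) B C ℕₚ.≤-refl

data Slot {N} (α β : ℤ) : Lattice N → Lattice N → Lattice N → Set where
  here  : ∀ {x y cs} → Slot α β (x ∷ cs) (y ∷ cs) (lin α x β y ∷ cs)
  there : ∀ {z X Y Z} → Slot α β X Y Z → Slot α β (z ∷ X) (z ∷ Y) (z ∷ Z)

-- An exchange of neighbours combined with a shear, of determinant -1: exactly the move that `push`
-- makes.
data Transvect {N} (c : ℤ) : Lattice N → Lattice N → Set where
  here  : ∀ {x y cs} → Transvect c (x ∷ y ∷ cs) (lin 1ℤ y c x ∷ x ∷ cs)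
  there : ∀ {z X Y} → Transvect c X Y → Transvect c (z ∷ X) (z ∷ Y)

record Alternating {N} (H : Lattice N → ℤ) : Set where
  field
    linear : ∀ {α β X Y Z} → Slot α β X Y Z → H Z ≡ α * H X + β * H Y
    flip   : ∀ {c X Y} → Transvect c X Y → H Y ≡ - H X
open Alternating

cons-alternating : ∀ {N} {H : Lattice N → ℤ} → Alternating H → ∀ z → Alternating (λ C → H (z ∷ C))
cons-alternating h z .linear s = linear h (there s)
cons-alternating h z .flip   t = flip h (there t)

-- A transvection at the head exchanges the two leading terms with opposite sign, while the two
-- terms containing `c` cancel. Deeper in the list the induction replaces `H` by `λ C → H (z ∷ C)`,
-- so `go` is general in `H`.
expand-alternating : ∀ {N} (f : Vec ℤ N → ℤ) → (∀ α x β y → f (lin α x β y) ≡ α * f x + β * f y) →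
                     ∀ {H} → Alternating H → Alternating (expand f H)
expand-alternating f f-lin h .linear s = go h s
  where
  rearrange : ∀ α β u v s t k → (α * u + β * v) * k - (α * s + β * t) ≡ α * (u * k - s) + β * (v * k - t)
  rearrange = solve-∀
  rearrange′ : ∀ α β u k l s t → u * (α * k + β * l) - (α * s + β * t) ≡ α * (u * k - s) + β * (u * l - t)
  rearrange′ = solve-∀
  go : ∀ {H} → Alternating H → ∀ {α β X Y Z} → Slot α β X Y Z →
       expand f H Z ≡ α * expand f H X + β * expand f H Y
  go {H} h {α} {β} (here {x} {y} {cs}) = trans
    (cong₂ (λ u s → u * H cs - s) (f-lin α x β y) (expand-linear f α β cs (λ ds → linear h {α} {β} here)))
    (rearrange α β (f x) (f y) _ _ (H cs))
  go {H} h {α} {β} (there {z} s) = trans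
    (cong₂ (λ k s → f z * k - s) (linear h s) (go (cons-alternating h z) s))
    (rearrange′ α β (f z) _ _ _ _)
expand-alternating f f-lin h .flip t = go h t
  where
  rearrange : ∀ c u v k l s → (1ℤ * v + c * u) * k - (u * (1ℤ * l + c * k) - - 1ℤ * s) ≡ - (u * l - (v * k - s))
  rearrange = solve-∀
  rearrange′ : ∀ u k s → u * - k - - s ≡ - (u * k - s)
  rearrange′ = solve-∀
  minus : ∀ s → - s ≡ - 1ℤ * s + 0ℤ * s
  minus = solve-∀
  minus′ : ∀ s → - 1ℤ * s + 0ℤ * s ≡ - 1ℤ * s
  minus′ = solve-∀
  go : ∀ {H} → Alternating H → ∀ {c X Y} → Transvect c X Y → expand f H Y ≡ - expand f H X
  go {H} h {c} (here {x} {y} {cs}) = trans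
    (cong₂ _-_ (cong (_* H (x ∷ cs)) (f-lin 1ℤ y c x))
      (cong₂ (λ k s → f x * k - s) (linear h {1ℤ} {c} here)
        -- The summand with coefficient zero is a dummy: the two-term lemma serves to pull out the
        -- factor -1.
        (trans (expand-linear f (- 1ℤ) 0ℤ {L = λ ds → H (x ∷ y ∷ ds)} cs (λ ds → trans (flip h {c} here) (minus _))) (minus′ _))))
    (rearrange c (f x) (f y) _ _ _)
  go {H} h (there {z} t) = trans
    (cong₂ (λ k s → f z * k - s) (flip h t) (go (cons-alternating h z) t))
    (rearrange′ (f z) _ _)

gramDet-alternating : ∀ {N} (B : Lattice N) → Alternating (gramDet B)
gramDet-alternating []       .linear {α} {β} here      = sym (cong₂ _+_ (ℤₚ.*-zeroʳ α) (ℤₚ.*-zeroʳ β))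
gramDet-alternating []       .linear {α} {β} (there s) = sym (cong₂ _+_ (ℤₚ.*-zeroʳ α) (ℤₚ.*-zeroʳ β))
gramDet-alternating []       .flip here      = refl
gramDet-alternating []       .flip (there t) = refl
gramDet-alternating (b ∷ bs) = expand-alternating (dot b) (dot-lin b) (gramDet-alternating bs)

sign-suc : ∀ n → sign (suc n) ≡ - sign n
sign-suc zero          = refl
sign-suc (suc zero)    = refl
sign-suc (suc (suc n)) = sign-suc n

sum-minus : ∀ {n} (g : Fin n → ℤ) → sumℤ (tabulate (λ j → - g j)) ≡ - sumℤ (tabulate g)
sum-minus {zero}  g = refl
sum-minus {suc n} g = trans (cong (_+_ (- g Fin.zero)) (sum-minus (λ j → g (Fin.suc j))))
                            (sym (ℤₚ.neg-distrib-+ (g Fin.zero) _))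

-- The alternating signs of the Laplace formula come from the nested subtractions in `expand`: every
-- entry passed contributes one factor -1.
laplace≡expand : ∀ {A : Set} {n} (f : A → ℤ) (H : List A → ℤ) (C : Vec A (suc n)) →
  sumℤ (tabulate (λ j → sign (toℕ j) * (f (lookup C j) * H (toList (removeAt C j))))) ≡ expand f H (toList C)
laplace≡expand {n = zero}  f H (c ∷ [])         = one (f c) (H [])
  where
  one : ∀ u h → 1ℤ * (u * h) + 0ℤ ≡ u * h - 0ℤ
  one = solve-∀
laplace≡expand {n = suc n} f H (c ∷ cs@(_ ∷ _)) =
  cong₂ _+_ (ℤₚ.*-identityˡ (f c * H (toList cs))) (begin
    sumℤ (tabulate (λ j → sign (suc (toℕ j)) * minor j))
      ≡⟨ cong sumℤ (Vecₚ.tabulate-cong (λ j → trans (cong (_* minor j) (sign-suc (toℕ j)))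
                                                    (sym (ℤₚ.neg-distribˡ-* (sign (toℕ j)) (minor j))))) ⟩
    sumℤ (tabulate (λ j → - (sign (toℕ j) * minor j)))
      ≡⟨ sum-minus (λ j → sign (toℕ j) * minor j) ⟩
    - sumℤ (tabulate (λ j → sign (toℕ j) * minor j))
      ≡⟨ cong -_ (laplace≡expand f (λ ds → H (c ∷ ds)) cs) ⟩
    - expand f (λ ds → H (c ∷ ds)) (toList cs) ∎)
  where
  minor : Fin (suc n) → ℤ
  minor j = f (lookup cs j) * H (c ∷ toList (removeAt cs j))

map-removeAt : ∀ {A B : Set} {n} (f : A → B) (xs : Vec A (suc n)) j →
               removeAt (map f xs) j ≡ map f (removeAt xs j)
map-removeAt f (x ∷ xs)         Fin.zero    = refl
map-removeAt f (x ∷ xs@(_ ∷ _)) (Fin.suc j) = cong (f x ∷_) (map-removeAt f xs j)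

det≡gramDet : ∀ {N n} (B C : Vec (Vec ℤ N) n) →
              det (map (λ u → map (dot u) C) B) ≡ gramDet (toList B) (toList C)
det≡gramDet []       []      = refl
det≡gramDet (b ∷ bs) C = trans
  (cong sumℤ (Vecₚ.tabulate-cong (λ j → cong (sign (toℕ j) *_) (cong₂ _*_
    (Vecₚ.lookup-map j (dot b) C)
    (trans (cong det (minor j)) (det≡gramDet bs (removeAt C j)))))))
  (laplace≡expand (dot b) (gramDet (toList bs)) C)
  where
  minor : ∀ j → map (λ row → removeAt row j) (map (λ u → map (dot u) C) bs) ≡ map (λ u → map (dot u) (removeAt C j)) bs
  minor j = trans (sym (Vecₚ.map-∘ (λ row → removeAt row j) (λ u → map (dot u) C) bs))
                  (Vecₚ.map-cong (λ u → map-removeAt (dot u) C j) bs)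

-- The root lattice

dot-zeroʳ : ∀ {N} (u : Vec ℤ N) → dot u (replicate N 0ℤ) ≡ 0ℤ
dot-zeroʳ []      = refl
dot-zeroʳ (a ∷ u) = cong₂ _+_ (ℤₚ.*-zeroʳ a) (dot-zeroʳ u)

simpleRoot : ∀ n → Vec ℤ (suc (suc n))
simpleRoot n = 1ℤ ∷ - 1ℤ ∷ replicate n 0ℤ

rootBasis : ∀ n → Vec (Vec ℤ (suc n)) n
rootBasis zero    = []
rootBasis (suc n) = simpleRoot n ∷ map (0ℤ ∷_) (rootBasis n)

expand-orthogonal : ∀ {A B : Set} (f : B → ℤ) (g : A → B) H C → (∀ c → f (g c) ≡ 0ℤ) →
                    expand f H (List.map g C) ≡ 0ℤ
expand-orthogonal f g H []       orth = refl
expand-orthogonal f g H (c ∷ cs) orth =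
  cong₂ (λ s t → s * H (List.map g cs) - t) (orth c) (expand-orthogonal f g _ cs orth)

expand-map : ∀ {A B : Set} (f : B → ℤ) (g : A → B) H C →
             expand f H (List.map g C) ≡ expand (λ c → f (g c)) (λ ds → H (List.map g ds)) C
expand-map f g H []       = refl
expand-map f g H (c ∷ cs) = cong (_-_ (f (g c) * H (List.map g cs))) (expand-map f g _ cs)

expand-cong₁ : ∀ {A : Set} {f g : A → ℤ} H C → (∀ c → f c ≡ g c) → expand f H C ≡ expand g H C
expand-cong₁ H []       eq = refl
expand-cong₁ H (c ∷ cs) eq = cong₂ (λ s t → s * H cs - t) (eq c) (expand-cong₁ _ cs eq)

gramDet-pad : ∀ {N} (B C : Lattice N) → gramDet (List.map (0ℤ ∷_) B) (List.map (0ℤ ∷_) C) ≡ gramDet B C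
gramDet-pad []       []      = refl
gramDet-pad []       (_ ∷ _) = refl
gramDet-pad (b ∷ bs) C       = begin
  expand (dot (0ℤ ∷ b)) (gramDet (List.map (0ℤ ∷_) bs)) (List.map (0ℤ ∷_) C)
    ≡⟨ expand-map (dot (0ℤ ∷ b)) (0ℤ ∷_) _ C ⟩
  expand (λ c → 0ℤ + dot b c) (λ ds → gramDet (List.map (0ℤ ∷_) bs) (List.map (0ℤ ∷_) ds)) C
    ≡⟨ expand-cong₁ _ C (λ c → ℤₚ.+-identityˡ (dot b c)) ⟩
  expand (dot b) (λ ds → gramDet (List.map (0ℤ ∷_) bs) (List.map (0ℤ ∷_) ds)) C
    ≡⟨ expand-cong (dot b) C (λ ds _ → gramDet-pad bs ds) ⟩
  expand (dot b) (gramDet bs) C ∎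

roots : ∀ n → Lattice (suc n)
roots n = toList (rootBasis n)

roots-suc : ∀ n → roots (suc n) ≡ simpleRoot n ∷ List.map (0ℤ ∷_) (roots n)
roots-suc n = cong (simpleRoot n ∷_) (Vecₚ.toList-map (0ℤ ∷_) (rootBasis n))

-- The continuant recurrence D(n+2) = 2 D(n+1) - D(n) of tridiagonal matrices: the first row is 2,
-- -1 and then zeros, and the minor at -1 is expanded, after transposition, along `b` again.
gramDet-path : ∀ {N} (b b′ : Vec ℤ N) (C : Lattice N) →
               dot b b ≡ + 2 → dot b b′ ≡ - 1ℤ → (∀ H → expand (dot b) H C ≡ 0ℤ) →
               gramDet (b ∷ b′ ∷ C) (b ∷ b′ ∷ C) ≡ + 2 * gramDet (b′ ∷ C) (b′ ∷ C) - gramDet C C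
gramDet-path b b′ C bb bb′ orth = begin
  dot b b * gramDet (b′ ∷ C) (b′ ∷ C) -
    (dot b b′ * gramDet (b′ ∷ C) (b ∷ C) - expand (dot b) (λ ds → gramDet (b′ ∷ C) (b ∷ b′ ∷ ds)) C)
    ≡⟨ cong₂ (λ s t → s * gramDet (b′ ∷ C) (b′ ∷ C) - t) bb (cong₂ _-_ (cong₂ _*_ bb′ cross) (orth _)) ⟩
  + 2 * gramDet (b′ ∷ C) (b′ ∷ C) - (- 1ℤ * (- 1ℤ * gramDet C C - 0ℤ) - 0ℤ)
    ≡⟨ cong (_-_ (+ 2 * gramDet (b′ ∷ C) (b′ ∷ C))) (simp (gramDet C C)) ⟩
  + 2 * gramDet (b′ ∷ C) (b′ ∷ C) - gramDet C C ∎
  where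
  simp : ∀ d → - 1ℤ * (- 1ℤ * d - 0ℤ) - 0ℤ ≡ d
  simp = solve-∀
  cross : gramDet (b′ ∷ C) (b ∷ C) ≡ - 1ℤ * gramDet C C - 0ℤ
  cross = trans (gramDet-sym (b′ ∷ C) (b ∷ C)) (cong₂ (λ s t → s * gramDet C C - t) bb′ (orth _))

gramDet-roots-step : ∀ n → gramDet (roots n) (roots n) ≡ + suc n →
  gramDet (roots (suc n)) (roots (suc n)) ≡ + suc (suc n) →
  gramDet (roots (suc (suc n))) (roots (suc (suc n))) ≡ + suc (suc (suc n))
gramDet-roots-step n ih₀ ih₁ = begin
  gramDet (roots (suc (suc n))) (roots (suc (suc n)))
    ≡⟨ cong (λ R → gramDet R R) split ⟩
  gramDet (b ∷ b′ ∷ C) (b ∷ b′ ∷ C)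
    ≡⟨ gramDet-path b b′ C bb bb′ orth ⟩
  + 2 * gramDet (b′ ∷ C) (b′ ∷ C) - gramDet C C
    ≡⟨ cong₂ (λ s t → + 2 * s - t) tail₁ tail₂ ⟩
  + 2 * + suc (suc n) - + suc n
    ≡⟨ arith (+ n) ⟩
  + suc (suc (suc n)) ∎
  where
  b b′ : Vec ℤ (suc (suc (suc n)))
  b  = simpleRoot (suc n)
  b′ = 0ℤ ∷ simpleRoot n
  -- The remaining roots vanish in the first two coordinates, which makes them orthogonal to `b`.
  C : Lattice (suc (suc (suc n)))
  C = List.map (0ℤ ∷_) (List.map (0ℤ ∷_) (roots n))
  split : roots (suc (suc n)) ≡ b ∷ b′ ∷ C
  split = trans (roots-suc (suc n)) (cong (λ R → b ∷ List.map (0ℤ ∷_) R) (roots-suc n))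
  bb : dot b b ≡ + 2
  bb = cong (λ z → 1ℤ + (1ℤ + (0ℤ + z))) (dot-zeroʳ (replicate n 0ℤ))
  bb′ : dot b b′ ≡ - 1ℤ
  bb′ = cong (λ z → 0ℤ + (- 1ℤ + (0ℤ + z))) (dot-zeroʳ (replicate n 0ℤ))
  dot-zeroˡ : ∀ c → dot b (0ℤ ∷ 0ℤ ∷ c) ≡ 0ℤ
  dot-zeroˡ c = cong (λ z → 0ℤ + (0ℤ + z)) (trans (dot-comm (replicate (suc n) 0ℤ) c) (dot-zeroʳ c))
  orth : ∀ H → expand (dot b) H C ≡ 0ℤ
  orth H = trans (expand-map (dot b) (0ℤ ∷_) H (List.map (0ℤ ∷_) (roots n)))
                 (expand-orthogonal (λ c → dot b (0ℤ ∷ c)) (0ℤ ∷_) _ (roots n) dot-zeroˡ)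
  tail₁ : gramDet (b′ ∷ C) (b′ ∷ C) ≡ + suc (suc n)
  tail₁ = trans (gramDet-pad (simpleRoot n ∷ List.map (0ℤ ∷_) (roots n)) (simpleRoot n ∷ List.map (0ℤ ∷_) (roots n)))
                (trans (cong (λ R → gramDet R R) (sym (roots-suc n))) ih₁)
  tail₂ : gramDet C C ≡ + suc n
  tail₂ = trans (gramDet-pad (List.map (0ℤ ∷_) (roots n)) (List.map (0ℤ ∷_) (roots n)))
                (trans (gramDet-pad (roots n) (roots n)) ih₀)
  arith : ∀ z → + 2 * (1ℤ + (1ℤ + z)) - (1ℤ + z) ≡ 1ℤ + (1ℤ + (1ℤ + z))
  arith = solve-∀

gramDet-roots : ∀ n → gramDet (roots n) (roots n) ≡ + suc n
gramDet-roots zero          = refl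
gramDet-roots (suc zero)    = refl
gramDet-roots (suc (suc n)) = gramDet-roots-step n (gramDet-roots n) (gramDet-roots (suc n))

latticeVec-pad : ∀ {N r} (B : Vec (Vec ℤ N) r) a → latticeVec (map (0ℤ ∷_) B) a ≡ 0ℤ ∷ latticeVec B a
latticeVec-pad []       []       = refl
latticeVec-pad (b ∷ bs) (a ∷ as) = trans
  (cong (zipWith _+_ (map (a *_) (0ℤ ∷ b))) (latticeVec-pad bs as))
  (cong (_∷ zipWith _+_ (map (a *_) b) (latticeVec bs as)) (trans (ℤₚ.+-identityʳ (a * 0ℤ)) (ℤₚ.*-zeroʳ a)))

zero-mul-add : ∀ {N} (x y : Vec ℤ N) → zipWith _+_ (map (0ℤ *_) x) y ≡ y
zero-mul-add []       []       = refl
zero-mul-add (x ∷ xs) (y ∷ ys) = cong₂ _∷_ (ℤₚ.+-identityˡ y) (zero-mul-add xs ys)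

-- Triangularity: only the first root has a nonzero first coordinate, so that coordinate isolates
-- `a` and leaves a relation of one rank less.
rootBasis-independent : ∀ n a → latticeVec (rootBasis n) a ≡ replicate (suc n) 0ℤ → a ≡ replicate n 0ℤ
rootBasis-independent zero    []       eq = refl
rootBasis-independent (suc n) (a ∷ as) eq = cong₂ _∷_ a≡0 (rootBasis-independent n as tail≡0)
  where
  padded : zipWith _+_ (map (a *_) (simpleRoot n)) (0ℤ ∷ latticeVec (rootBasis n) as) ≡ replicate (suc (suc n)) 0ℤ
  padded = trans (cong (zipWith _+_ (map (a *_) (simpleRoot n))) (sym (latticeVec-pad (rootBasis n) as))) eq
  a≡0 : a ≡ 0ℤ
  a≡0 = trans (sym (trans (ℤₚ.+-identityʳ (a * 1ℤ)) (ℤₚ.*-identityʳ a))) (Vecₚ.∷-injectiveˡ padded)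
  tail≡0 : latticeVec (rootBasis n) as ≡ replicate (suc n) 0ℤ
  tail≡0 = trans (sym (zero-mul-add (- 1ℤ ∷ replicate n 0ℤ) _))
    (trans (cong (λ z → zipWith _+_ (map (z *_) (- 1ℤ ∷ replicate n 0ℤ)) (latticeVec (rootBasis n) as)) (sym a≡0))
           (Vecₚ.∷-injectiveʳ padded))

dot-mul-add : ∀ {N} (h : Vec ℤ N) a x y → dot h (zipWith _+_ (map (a *_) x) y) ≡ a * dot h x + dot h y
dot-mul-add []      a []       []       = sym (cong (_+ 0ℤ) (ℤₚ.*-zeroʳ a))
dot-mul-add (u ∷ h) a (x ∷ xs) (y ∷ ys) =
  trans (cong (_+_ (u * (a * x + y))) (dot-mul-add h a xs ys)) (lemma u a x y (dot h xs) (dot h ys))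
  where
  lemma : ∀ u a x y s t → u * (a * x + y) + (a * s + t) ≡ a * (u * x + s) + (u * y + t)
  lemma = solve-∀

dot-rootBasis : ∀ n a → dot (replicate (suc n) 1ℤ) (latticeVec (rootBasis n) a) ≡ 0ℤ
dot-rootBasis zero    []       = refl
dot-rootBasis (suc n) (a ∷ as) = begin
  dot (replicate (suc (suc n)) 1ℤ) (latticeVec (rootBasis (suc n)) (a ∷ as))
    ≡⟨ dot-mul-add (replicate (suc (suc n)) 1ℤ) a (simpleRoot n) (latticeVec (map (0ℤ ∷_) (rootBasis n)) as) ⟩
  a * dot (replicate (suc (suc n)) 1ℤ) (simpleRoot n) +
    dot (replicate (suc (suc n)) 1ℤ) (latticeVec (map (0ℤ ∷_) (rootBasis n)) as)
    ≡⟨ cong₂ (λ s t → a * s + t) (cong (λ z → 1ℤ + (- 1ℤ + z)) (dot-zeroʳ (replicate n 1ℤ)))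
         (trans (cong (dot (replicate (suc (suc n)) 1ℤ)) (latticeVec-pad (rootBasis n) as))
                (cong (_+_ 0ℤ) (dot-rootBasis n as))) ⟩
  a * 0ℤ + 0ℤ
    ≡⟨ cong (_+ 0ℤ) (ℤₚ.*-zeroʳ a) ⟩
  0ℤ ∎

-- Sublattices cut out by congruences

prime-coprime : ∀ {p} n → Prime p → ¬ (p ℕ∣.∣ n) → Coprime p n
prime-coprime n pr p∤n (d∣p , d∣n) with prime⇒irreducible pr d∣p
... | inj₁ d≡1  = d≡1
... | inj₂ refl = ⊥-elim (p∤n d∣n)

-- The inverse is taken with a minus sign, u n ≡ -1, so that in `kernel` adding `dot h y * u` times
-- `b` to `y` cancels `dot h y` modulo `p`.
invertible-ℕ : ∀ {p} n → Prime p → ¬ (p ℕ∣.∣ n) → ∃ λ u → + p ∣ 1ℤ + u * + n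
invertible-ℕ {p} n pr p∤n with coprime-Bézout (prime-coprime n pr p∤n)
... | Bézout.+- x y eq = + y , divides (+ x) (trans (cong (_+_ 1ℤ) (sym (ℤₚ.pos-* y n))) (trans (cong +_ eq) (ℤₚ.pos-* x p)))
... | Bézout.-+ x y eq = - (+ y) , divides (- (+ x)) (begin
  1ℤ + - (+ y) * + n        ≡⟨ lemma₁ (+ y) (+ n) ⟩
  1ℤ - + y * + n            ≡⟨ cong (_-_ 1ℤ) (sym (ℤₚ.pos-* y n)) ⟩
  1ℤ - + (y ℕ.* n)          ≡⟨ cong (λ z → 1ℤ - + z) (sym eq) ⟩
  1ℤ - + (1 ℕ.+ x ℕ.* p)    ≡⟨ cong (λ z → 1ℤ - (1ℤ + z)) (ℤₚ.pos-* x p) ⟩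
  1ℤ - (1ℤ + + x * + p)     ≡⟨ lemma₂ (+ x) (+ p) ⟩
  - (+ x) * + p             ∎)
  where
  lemma₁ : ∀ y n → 1ℤ + - y * n ≡ 1ℤ - y * n
  lemma₁ = solve-∀
  lemma₂ : ∀ x p → 1ℤ - (1ℤ + x * p) ≡ - x * p
  lemma₂ = solve-∀

invertible : ∀ {p} z → Prime p → ¬ (+ p ∣ z) → ∃ λ u → + p ∣ 1ℤ + u * z
invertible (+ n)      pr p∤z = invertible-ℕ n pr (λ d → p∤z (∣ᵤ⇒∣ d))
invertible {p} -[1+ n ] pr p∤z with invertible-ℕ (suc n) pr (λ d → p∤z (∣ᵤ⇒∣ d))
... | u , d = - u , subst (+ p ∣_) (lemma u (+ suc n)) d
  where
  lemma : ∀ u z → 1ℤ + u * z ≡ 1ℤ + - u * - z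
  lemma = solve-∀

-- Pushing b to the end of the list by steps (b, y) ↦ (y + γ y b, b).
push : ∀ {N r} → (Vec ℤ N → ℤ) → ℤ → Vec ℤ N → Vec (Vec ℤ N) r → Vec (Vec ℤ N) (suc r)
push γ p b []       = lin p b 0ℤ b ∷ []
push γ p b (y ∷ ys) = lin 1ℤ y (γ y) b ∷ push γ p b ys

-- Every step of `push` is a transvection and contributes -1; the last vector, `b` multiplied by
-- `p`, contributes `p`.
push-alternating : ∀ {N r} (γ : Vec ℤ N → ℤ) p b (B : Vec (Vec ℤ N) r) {H} → Alternating H →
                   H (toList (push γ p b B)) ≡ sign r * p * H (b ∷ toList B)
-- `lin p b 0ℤ b` is `p` times `b` in the two-term form that `linear` accepts.
push-alternating γ p b []       {H} h = trans (Alternating.linear h {p} {0ℤ} here) (lemma p (H (b ∷ [])))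
  where
  lemma : ∀ p x → p * x + 0ℤ * x ≡ 1ℤ * p * x
  lemma = solve-∀
push-alternating {r = suc r} γ p b (y ∷ ys) {H} h = begin
  H (lin 1ℤ y (γ y) b ∷ toList (push γ p b ys))
    ≡⟨ push-alternating γ p b ys (cons-alternating h (lin 1ℤ y (γ y) b)) ⟩
  sign r * p * H (lin 1ℤ y (γ y) b ∷ b ∷ toList ys)
    ≡⟨ cong (sign r * p *_) (Alternating.flip h {γ y} here) ⟩
  sign r * p * - H (b ∷ y ∷ toList ys)
    ≡⟨ lemma (sign r) p _ ⟩
  - sign r * p * H (b ∷ y ∷ toList ys)
    ≡⟨ cong (λ s → s * p * H (b ∷ y ∷ toList ys)) (sign-suc r) ⟨
  sign (suc r) * p * H (b ∷ y ∷ toList ys) ∎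
  where
  lemma : ∀ s p x → s * p * - x ≡ - s * p * x
  lemma = solve-∀

-- The implication transports linear independence: a nonzero coefficient vector over `B′` yields a
-- nonzero one over `B`.
Finer : ∀ {N r} → Vec (Vec ℤ N) r → Vec (Vec ℤ N) r → Set
Finer {r = r} B′ B = ∀ a → ∃ λ a′ → latticeVec B′ a ≡ latticeVec B a′ × (a′ ≡ replicate r 0ℤ → a ≡ replicate r 0ℤ)

Finer-refl : ∀ {N r} {B : Vec (Vec ℤ N) r} → Finer B B
Finer-refl a = a , refl , λ eq → eq

Finer-trans : ∀ {N r} {B C D : Vec (Vec ℤ N) r} → Finer B C → Finer C D → Finer B D
Finer-trans f g a with f a
... | a′ , eq , z with g a′
... | a″ , eq′ , z′ = a″ , trans eq eq′ , λ e → z (z′ e)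

Finer-cons : ∀ {N r} b {B C : Vec (Vec ℤ N) r} → Finer B C → Finer (b ∷ B) (b ∷ C)
Finer-cons b f (a ∷ as) with f as
... | as′ , eq , z = a ∷ as′ , cong (zipWith _+_ (map (a *_) b)) eq ,
  λ e → cong₂ _∷_ (Vecₚ.∷-injectiveˡ e) (z (Vecₚ.∷-injectiveʳ e))

push-finer : ∀ {N r} (γ : Vec ℤ N → ℤ) p .{{_ : ℤ.NonZero p}} b (B : Vec (Vec ℤ N) r) → Finer (push γ p b B) (b ∷ B)
push-finer γ p b [] (a ∷ []) =
  a * p ∷ [] , cong (λ x → zipWith _+_ x (replicate _ 0ℤ)) (scale b) , λ e → cong (_∷ []) (cancel (Vecₚ.∷-injectiveˡ e))
  where
  lemma : ∀ a p x → a * (p * x + 0ℤ * x) ≡ a * p * x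
  lemma = solve-∀
  scale : ∀ {N} (b : Vec ℤ N) → map (a *_) (lin p b 0ℤ b) ≡ map (a * p *_) b
  scale []      = refl
  scale (x ∷ b) = cong₂ _∷_ (lemma a p x) (scale b)
  cancel : a * p ≡ 0ℤ → a ≡ 0ℤ
  cancel e with ℤₚ.i*j≡0⇒i≡0∨j≡0 a e
  ... | inj₁ a≡0 = a≡0
  ... | inj₂ p≡0 = ⊥-elim (ℕ.≢-nonZero⁻¹ ∣ p ∣ (cong ∣_∣ p≡0))
push-finer γ p b (y ∷ ys) (a ∷ as) with push-finer γ p b ys as
-- The tail uses `b` with coefficient `t`, and the vector made from `y` adds `a * γ y` to it. If all
-- these coefficients vanish, so does `a`, and then `t`.
... | t ∷ ts , eq , z = (t + a * γ y) ∷ a ∷ ts ,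
  trans (cong (zipWith _+_ (map (a *_) (lin 1ℤ y (γ y) b))) eq) (vec y b _) , zeros
  where
  lemma : ∀ a g t x b w → a * (1ℤ * x + g * b) + (t * b + w) ≡ (t + a * g) * b + (a * x + w)
  lemma = solve-∀
  vec : ∀ {N} (x b w : Vec ℤ N) → zipWith _+_ (map (a *_) (lin 1ℤ x (γ y) b)) (zipWith _+_ (map (t *_) b) w)
        ≡ zipWith _+_ (map ((t + a * γ y) *_) b) (zipWith _+_ (map (a *_) x) w)
  vec []      []      []      = refl
  vec (x ∷ xs) (b ∷ bs) (w ∷ ws) = cong₂ _∷_ (lemma a (γ y) t x b w) (vec xs bs ws)
  zeros : (t + a * γ y) ∷ a ∷ ts ≡ replicate _ 0ℤ → a ∷ as ≡ replicate _ 0ℤ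
  zeros e = cong₂ _∷_ a≡0 (z (cong₂ _∷_ t≡0 (Vecₚ.∷-injectiveʳ (Vecₚ.∷-injectiveʳ e))))
    where
    a≡0 : a ≡ 0ℤ
    a≡0 = Vecₚ.∷-injectiveˡ (Vecₚ.∷-injectiveʳ e)
    t≡0 : t ≡ 0ℤ
    t≡0 = trans (sym (trans (cong (λ z → t + z * γ y) a≡0) (ℤₚ.+-identityʳ t))) (Vecₚ.∷-injectiveˡ e)

-- The hypothesis on `γ` says, in the form produced by `dot-lin`, that the vector made from `y`
-- satisfies the congruence; the last vector does so as a multiple of `p`.
push-divides : ∀ {N r} (h : Vec ℤ N) (γ : Vec ℤ N → ℤ) p b (B : Vec (Vec ℤ N) r) →
               (∀ y → p ∣ 1ℤ * dot h y + γ y * dot h b) → ∀ a → p ∣ dot h (latticeVec (push γ p b B) a)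
push-divides h γ p b [] div (a ∷ []) = divides (a * dot h b) (begin
  dot h (zipWith _+_ (map (a *_) (lin p b 0ℤ b)) (replicate _ 0ℤ))
    ≡⟨ dot-mul-add h a (lin p b 0ℤ b) (replicate _ 0ℤ) ⟩
  a * dot h (lin p b 0ℤ b) + dot h (replicate _ 0ℤ)
    ≡⟨ cong₂ (λ s t → a * s + t) (dot-lin h p b 0ℤ b) (dot-zeroʳ h) ⟩
  a * (p * dot h b + 0ℤ * dot h b) + 0ℤ
    ≡⟨ lemma a p (dot h b) ⟩
  a * dot h b * p ∎)
  where
  lemma : ∀ a p x → a * (p * x + 0ℤ * x) + 0ℤ ≡ a * x * p
  lemma = solve-∀
push-divides h γ p b (y ∷ ys) div (a ∷ as) =
  subst (p ∣_) (sym (dot-mul-add h a (lin 1ℤ y (γ y) b) (latticeVec (push γ p b ys) as)))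
    (∣m∣n⇒∣m+n (∣n⇒∣m*n a (subst (p ∣_) (sym (dot-lin h 1ℤ y (γ y) b)) (div y))) (push-divides h γ p b ys div as))

-- A basis of a sublattice of the span of B on which P holds; scale is its index up to sign.
record Sublattice {N r} (P : Vec ℤ N → Set) (bound : ℤ) (B : Vec (Vec ℤ N) r) : Set where
  field
    basis       : Vec (Vec ℤ N) r
    finer       : Finer basis B
    holds       : ∀ a → P (latticeVec basis a)
    scale       : ℤ
    alternating : ∀ {H} → Alternating H → H (toList basis) ≡ scale * H (toList B)
    scale-pos   : 0ℤ ℤ.< scale * scale
    scale-bound : scale * scale ℤ.≤ bound

sign-square : ∀ n → sign n * sign n ≡ 1ℤ
sign-square zero          = refl
sign-square (suc zero)    = refl
sign-square (suc (suc n)) = sign-square n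

prime-square-pos : ∀ {p} → Prime p → 0ℤ ℤ.< + p * + p
prime-square-pos {p} pr = subst (0ℤ ℤ.<_) (ℤₚ.pos-* p p)
  (+<+ (ℕ.>-nonZero⁻¹ (p ℕ.* p) {{ℕₚ.m*n≢0 p p {{prime⇒nonZero pr}} {{prime⇒nonZero pr}}}}))

-- Basis vectors satisfying the congruence are kept until the first one that fails. That `b` is the
-- pivot: it corrects all later vectors at once and is itself multiplied by `p`. The index is `p` up
-- to sign if a pivot occurs and 1 otherwise, hence only an upper bound on its square.
kernel : ∀ {N r} (h : Vec ℤ N) {p} → Prime p → (B : Vec (Vec ℤ N) r) → Sublattice (λ v → + p ∣ dot h v) (+ p * + p) B
kernel h {p} pr [] = record
  { basis = [] ; finer = Finer-refl {B = []} ; holds = λ where [] → divides 0ℤ (dot-zeroʳ h)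
  ; scale = 1ℤ ; alternating = λ {H} _ → sym (ℤₚ.*-identityˡ (H [])) ; scale-pos = +<+ (s≤s z≤n)
  ; scale-bound = ℤₚ.i<j⇒suc[i]≤j (prime-square-pos pr) }
kernel {r = suc r} h {p} pr (b ∷ bs) with + p ∣? dot h b
... | yes p∣hb = record
  { basis = b ∷ K.basis ; finer = Finer-cons b K.finer
  ; holds = λ where
      (a ∷ as) → subst (+ p ∣_) (sym (dot-mul-add h a b (latticeVec K.basis as)))
                       (∣m∣n⇒∣m+n (∣n⇒∣m*n a p∣hb) (K.holds as))
  ; scale = K.scale ; alternating = λ alt → K.alternating (cons-alternating alt b)
  ; scale-pos = K.scale-pos ; scale-bound = K.scale-bound }
  where module K = Sublattice (kernel h pr bs)
... | no p∤hb = record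
  { basis = push γ (+ p) b bs ; finer = push-finer γ (+ p) {{prime⇒nonZero pr}} b bs
  ; holds = push-divides h γ (+ p) b bs γ-div
  ; scale = sign r * + p ; alternating = push-alternating γ (+ p) b bs
  ; scale-pos = subst (0ℤ ℤ.<_) (sym square) (prime-square-pos pr)
  ; scale-bound = ℤₚ.≤-reflexive square }
  where
  u : ℤ
  u = proj₁ (invertible (dot h b) pr p∤hb)
  γ : Vec ℤ _ → ℤ
  γ y = dot h y * u
  lemma : ∀ x u z → x * (1ℤ + u * z) ≡ 1ℤ * x + x * u * z
  lemma = solve-∀
  γ-div : ∀ y → + p ∣ 1ℤ * dot h y + γ y * dot h b
  γ-div y = subst (+ p ∣_) (lemma (dot h y) u (dot h b)) (∣n⇒∣m*n (dot h y) (proj₂ (invertible (dot h b) pr p∤hb)))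
  rearrange : ∀ s p → s * p * (s * p) ≡ s * s * (p * p)
  rearrange = solve-∀
  square : sign r * + p * (sign r * + p) ≡ + p * + p
  square = trans (rearrange (sign r) (+ p)) (trans (cong (_* (+ p * + p)) (sign-square r)) (ℤₚ.*-identityˡ (+ p * + p)))

square-*-≤ : ∀ {x y b c} → x * x ℤ.≤ b → y * y ℤ.≤ c → 0ℤ ℤ.< y * y → 0ℤ ℤ.< x * x → x * y * (x * y) ℤ.≤ b * c
square-*-≤ {x} {y} {b} {c} x≤ y≤ y>0 x>0 = subst (ℤ._≤ b * c) (sym (lemma x y))
  (ℤₚ.≤-trans (ℤₚ.*-monoʳ-≤-nonNeg (y * y) {{ℤ.nonNegative (ℤₚ.<⇒≤ y>0)}} x≤)
              (ℤₚ.*-monoˡ-≤-nonNeg b {{ℤ.nonNegative (ℤₚ.<⇒≤ (ℤₚ.<-≤-trans x>0 x≤))}} y≤))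
  where
  lemma : ∀ x y → x * y * (x * y) ≡ x * x * (y * y)
  lemma = solve-∀

square-*-pos : ∀ {x y} → 0ℤ ℤ.< x * x → 0ℤ ℤ.< y * y → 0ℤ ℤ.< x * y * (x * y)
square-*-pos {x} {y} x>0 y>0 = subst (0ℤ ℤ.<_) (sym (lemma x y))
  (subst (ℤ._< x * x * (y * y)) (ℤₚ.*-zeroʳ (x * x)) (ℤₚ.*-monoˡ-<-pos (x * x) {{ℤ.positive x>0}} y>0))
  where
  lemma : ∀ x y → x * y * (x * y) ≡ x * x * (y * y)
  lemma = solve-∀

-- `P` survives because each vector of the smaller lattice is, with the coefficients given by
-- `T.finer`, a vector of `S`.
compose : ∀ {N r} {P Q : Vec ℤ N → Set} {b c} {B : Vec (Vec ℤ N) r} (S : Sublattice P b B) →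
      Sublattice Q c (Sublattice.basis S) → Sublattice (λ v → P v × Q v) (c * b) B
compose {P = P} {B = B} S T = record
  { basis = T.basis ; finer = Finer-trans {B = T.basis} {S.basis} {B} T.finer S.finer
  ; holds = λ a → subst P (sym (proj₁ (proj₂ (T.finer a)))) (S.holds (proj₁ (T.finer a))) , T.holds a
  ; scale = T.scale * S.scale
  ; alternating = λ {H} alt → trans (T.alternating alt)
      (trans (cong (T.scale *_) (S.alternating alt)) (sym (ℤₚ.*-assoc T.scale S.scale (H _))))
  ; scale-pos = square-*-pos {T.scale} {S.scale} T.scale-pos S.scale-pos
  ; scale-bound = square-*-≤ {T.scale} {S.scale} T.scale-bound S.scale-bound S.scale-pos T.scale-pos }
  where
  module S = Sublattice S
  module T = Sublattice T

kernels : ∀ {N r s} (hs : Vec (Vec ℤ N) s) {p} → Prime p → (B : Vec (Vec ℤ N) r) →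
          Sublattice (λ v → All (λ h → + p ∣ dot h v) hs) ((+ p * + p) ℤ.^ s) B
kernels []       pr B = record
  { basis = B ; finer = Finer-refl {B = B} ; holds = λ _ → [] ; scale = 1ℤ
  ; alternating = λ {H} _ → sym (ℤₚ.*-identityˡ (H (toList B))) ; scale-pos = +<+ (s≤s z≤n) ; scale-bound = ℤₚ.≤-refl }
kernels (h ∷ hs) {p} pr B = record
  { basis = T.basis ; finer = T.finer ; holds = λ a → proj₂ (T.holds a) ∷ proj₁ (T.holds a)
  ; scale = T.scale ; alternating = T.alternating ; scale-pos = T.scale-pos ; scale-bound = T.scale-bound }
  where
  S = kernels hs pr B
  module T = Sublattice (compose S (kernel h pr (Sublattice.basis S)))

-- The scale comes out once for the columns and, after a use of symmetry, once more for the rows.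
gramDet-sublattice : ∀ {N r} {P : Vec ℤ N → Set} {b} {B : Vec (Vec ℤ N) r} (S : Sublattice P b B) →
  let open Sublattice S in
  gramDet (toList basis) (toList basis) ≡ scale * scale * gramDet (toList B) (toList B)
gramDet-sublattice {B = B} S = begin
  gramDet (toList basis) (toList basis)         ≡⟨ alternating (gramDet-alternating (toList basis)) ⟩
  scale * gramDet (toList basis) (toList B)     ≡⟨ cong (scale *_) (gramDet-sym (toList basis) (toList B)) ⟩
  scale * gramDet (toList B) (toList basis)     ≡⟨ cong (scale *_) (alternating (gramDet-alternating (toList B))) ⟩
  scale * (scale * gramDet (toList B) (toList B)) ≡⟨ ℤₚ.*-assoc scale scale _ ⟨
  scale * scale * gramDet (toList B) (toList B) ∎
  where open Sublattice S

-- Power sums modulo a prime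

prime-cancel : ∀ {p} a b → Prime p → ¬ (+ p ∣ a) → + p ∣ a * b → + p ∣ b
prime-cancel {p} a b pr p∤a p∣ab with invertible a pr p∤a
... | u , d = subst (+ p ∣_) (lemma a b u) (∣m∣n⇒∣m-n (∣n⇒∣m*n b d) (∣n⇒∣m*n u p∣ab))
  where
  lemma : ∀ a b u → b * (1ℤ + u * a) - u * (a * b) ≡ b
  lemma = solve-∀

shift : (ℕ → ℤ) → ℕ → ℤ
shift f zero    = 0ℤ
shift f (suc j) = f j

-- The coefficient of X^j in the product of the 1 − x X, x ∈ xs.
elem : List ℕ → ℕ → ℤ
elem []       zero    = 1ℤ
elem []       (suc j) = 0ℤ
elem (x ∷ xs) j       = elem xs j - + x * shift (elem xs) j

powerSum : List ℕ → ℕ → ℤ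
powerSum []       i = 0ℤ
powerSum (x ∷ xs) i = (+ x) ^ i + powerSum xs i

-- The coefficient of X^j in X f g, for power series f and g.
conv : (ℕ → ℤ) → (ℕ → ℤ) → ℕ → ℤ
conv f g zero    = 0ℤ
conv f g (suc j) = f 0 * g j + conv (λ i → f (suc i)) g j

conv-+ˡ : ∀ f f′ g j → conv (λ i → f i + f′ i) g j ≡ conv f g j + conv f′ g j
conv-+ˡ f f′ g zero    = refl
conv-+ˡ f f′ g (suc j) =
  trans (cong (_+_ ((f 0 + f′ 0) * g j)) (conv-+ˡ _ _ g j)) (lemma (f 0) (f′ 0) (g j) _ _)
  where
  lemma : ∀ a b c s t → (a + b) * c + (s + t) ≡ a * c + s + (b * c + t)
  lemma = solve-∀

conv-scaleˡ : ∀ c f g j → conv (λ i → c * f i) g j ≡ c * conv f g j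
conv-scaleˡ c f g zero    = sym (ℤₚ.*-zeroʳ c)
conv-scaleˡ c f g (suc j) =
  trans (cong (_+_ (c * f 0 * g j)) (conv-scaleˡ c _ g j)) (lemma c (f 0) (g j) _)
  where
  lemma : ∀ c a b s → c * a * b + c * s ≡ c * (a * b + s)
  lemma = solve-∀

conv-linearʳ : ∀ f g h x j → conv f (λ i → g i - x * h i) j ≡ conv f g j - x * conv f h j
conv-linearʳ f g h x zero    = sym (trans (ℤₚ.+-identityˡ _) (cong -_ (ℤₚ.*-zeroʳ x)))
conv-linearʳ f g h x (suc j) =
  trans (cong (_+_ (f 0 * (g j - x * h j))) (conv-linearʳ _ g h x j)) (lemma (f 0) (g j) (h j) x _ _)
  where
  lemma : ∀ a b c x s t → a * (b - x * c) + (s - x * t) ≡ a * b + s - x * (a * c + t)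
  lemma = solve-∀

conv-shift : ∀ f g j → conv f (shift g) (suc j) ≡ conv f g j
conv-shift f g zero    = trans (ℤₚ.+-identityʳ (f 0 * 0ℤ)) (ℤₚ.*-zeroʳ (f 0))
conv-shift f g (suc j) = cong (_+_ (f 0 * g j)) (conv-shift _ g j)

-- The geometric series Σ x^(i+1) X^(i+1) is x X / (1 − x X), which cancels the new factor of elem.
conv-geometric : ∀ x g j → conv (λ i → x ^ suc i) (λ i → g i - x * shift g i) j ≡ x * shift g j
conv-geometric x g zero    = sym (ℤₚ.*-zeroʳ x)
conv-geometric x g (suc j) = begin
  x ^ 1 * (g j - x * shift g j) + conv (λ i → x * x ^ suc i) (λ i → g i - x * shift g i) j
    ≡⟨ cong₂ (λ s t → s * (g j - x * shift g j) + t) (ℤₚ.*-identityʳ x)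
         (trans (conv-scaleˡ x (λ i → x ^ suc i) _ j) (cong (x *_) (conv-geometric x g j))) ⟩
  x * (g j - x * shift g j) + x * (x * shift g j)
    ≡⟨ lemma x (g j) (shift g j) ⟩
  x * g j ∎
  where
  lemma : ∀ x a b → x * (a - x * b) + x * (x * b) ≡ x * a
  lemma = solve-∀

-- Newton's identities, as the coefficients of P E = -X E′, where E is the product of the 1 - x X
-- and P the sum of the p_i X^i over i ≥ 1. Adjoining x is the product rule: `conv-geometric`
-- differentiates the new factor, and the old identity is applied to E and to X E.
newton : ∀ xs j → conv (λ i → powerSum xs (suc i)) (elem xs) j ≡ - (+ j * elem xs j)
newton xs       zero    = sym (cong -_ (ℤₚ.*-zeroˡ (elem xs 0)))
newton []       (suc j) = trans (zeros (suc j)) (sym (cong -_ (ℤₚ.*-zeroʳ (+ suc j))))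
  where
  zeros : ∀ j → conv (λ _ → 0ℤ) (elem []) j ≡ 0ℤ
  zeros zero    = refl
  zeros (suc j) = cong₂ _+_ (ℤₚ.*-zeroˡ (elem [] j)) (zeros j)
newton (x ∷ xs) (suc j) = begin
  conv (λ i → (+ x) ^ suc i + powerSum xs (suc i)) (elem (x ∷ xs)) (suc j)
    ≡⟨ conv-+ˡ (λ i → (+ x) ^ suc i) (λ i → powerSum xs (suc i)) (elem (x ∷ xs)) (suc j) ⟩
  conv (λ i → (+ x) ^ suc i) (elem (x ∷ xs)) (suc j) + conv (λ i → powerSum xs (suc i)) (elem (x ∷ xs)) (suc j)
    ≡⟨ cong₂ _+_ (conv-geometric (+ x) (elem xs) (suc j))
         (conv-linearʳ (λ i → powerSum xs (suc i)) (elem xs) (shift (elem xs)) (+ x) (suc j)) ⟩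
  + x * elem xs j +
    (conv (λ i → powerSum xs (suc i)) (elem xs) (suc j) - + x * conv (λ i → powerSum xs (suc i)) (shift (elem xs)) (suc j))
    ≡⟨ cong₂ (λ s t → + x * elem xs j + (s - + x * t)) (newton xs (suc j))
         (trans (conv-shift (λ i → powerSum xs (suc i)) (elem xs) j) (newton xs j)) ⟩
  + x * elem xs j + (- (+ suc j * elem xs (suc j)) - + x * - (+ j * elem xs j))
    ≡⟨ lemma (+ x) (elem xs j) (elem xs (suc j)) (+ j) ⟩
  - (+ suc j * (elem xs (suc j) - + x * elem xs j)) ∎
  where
  lemma : ∀ x a b j → x * a + (- ((1ℤ + j) * b) - x * - (j * a)) ≡ - ((1ℤ + j) * (b - x * a))
  lemma = solve-∀

elem-vanishes : ∀ xs j → length xs < j → elem xs j ≡ 0ℤ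
elem-vanishes []       (suc j) _         = refl
elem-vanishes (x ∷ xs) (suc j) (s≤s len) =
  cong₂ (λ s t → s - t) (elem-vanishes xs (suc j) (ℕₚ.m<n⇒m<1+n len))
    (trans (cong (+ x *_) (elem-vanishes xs j len)) (ℤₚ.*-zeroʳ (+ x)))

-- Horner's scheme for the sum of the f(j) t^(s-j), with `f 0` as leading coefficient. This reversal
-- turns the product of the 1 - x X into that of the t - x.
horner : (ℕ → ℤ) → ℤ → ℕ → ℤ
horner f t zero    = f 0
horner f t (suc s) = t * horner f t s + f (suc s)

horner-linear : ∀ f g x t s → horner (λ j → f j - x * g j) t s ≡ horner f t s - x * horner g t s
horner-linear f g x t zero    = refl
horner-linear f g x t (suc s) =
  trans (cong (λ z → t * z + (f (suc s) - x * g (suc s))) (horner-linear f g x t s)) (lemma t x _ _ _ _)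
  where
  lemma : ∀ t x a b c d → t * (a - x * b) + (c - x * d) ≡ t * a + c - x * (t * b + d)
  lemma = solve-∀

horner-shift : ∀ f t s → horner (shift f) t (suc s) ≡ horner f t s
horner-shift f t zero    = trans (cong (_+ f 0) (ℤₚ.*-zeroʳ t)) (ℤₚ.+-identityˡ (f 0))
horner-shift f t (suc s) = cong (λ z → t * z + f (suc s)) (horner-shift f t s)

rootProduct : ℤ → List ℕ → ℤ
rootProduct t []       = 1ℤ
rootProduct t (x ∷ xs) = (t - + x) * rootProduct t xs

rootProduct≡horner : ∀ t xs → rootProduct t xs ≡ horner (elem xs) t (length xs)
rootProduct≡horner t []       = refl
rootProduct≡horner t (x ∷ xs) = begin
  (t - + x) * rootProduct t xs
    ≡⟨ cong ((t - + x) *_) (rootProduct≡horner t xs) ⟩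
  (t - + x) * horner (elem xs) t n
    ≡⟨ lemma t (+ x) _ ⟩
  -- The `0ℤ` is the coefficient of `elem xs` just above its degree, so one more Horner step only
  -- multiplies by `t`.
  t * horner (elem xs) t n + 0ℤ - + x * horner (elem xs) t n
    ≡⟨ cong₂ (λ a b → t * horner (elem xs) t n + a - + x * b) (elem-vanishes xs (suc n) ℕₚ.≤-refl) (horner-shift (elem xs) t n) ⟨
  horner (elem xs) t (suc n) - + x * horner (shift (elem xs)) t (suc n)
    ≡⟨ horner-linear (elem xs) (shift (elem xs)) (+ x) t (suc n) ⟨
  horner (elem (x ∷ xs)) t (suc n) ∎
  where
  n = length xs
  lemma : ∀ t x a → (t - x) * a ≡ t * a + 0ℤ - x * a
  lemma = solve-∀

-- Congruence is demanded only below `j`, because the extra factor X in `conv` keeps the `j`-th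
-- coefficients out; the induction in `elem-mod` depends on this.
conv-mod : ∀ {p} f f′ g g′ j → (∀ i → i < j → p ∣ f i - f′ i) → (∀ i → i < j → p ∣ g i - g′ i) →
           p ∣ conv f g j - conv f′ g′ j
conv-mod f f′ g g′ zero    _   _   = divides 0ℤ refl
conv-mod {p} f f′ g g′ (suc j) f≈ g≈ = subst (p ∣_) (lemma (f 0) (f′ 0) (g j) (g′ j) _ _)
  (∣m∣n⇒∣m+n (∣m∣n⇒∣m+n (∣n⇒∣m*n (f 0) (g≈ j ℕₚ.≤-refl)) (∣m⇒∣m*n (g′ j) (f≈ 0 (s≤s z≤n))))
             (conv-mod (λ i → f (suc i)) (λ i → f′ (suc i)) g g′ j (λ i i<j → f≈ (suc i) (s≤s i<j)) (λ i i<j → g≈ i (ℕₚ.m<n⇒m<1+n i<j))))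
  where
  lemma : ∀ a b c d s t → a * (c - d) + (a - b) * d + (s - t) ≡ a * c + s - (b * d + t)
  lemma = solve-∀

horner-mod : ∀ {p} f f′ t s → (∀ j → j ≤ s → p ∣ f j - f′ j) → p ∣ horner f t s - horner f′ t s
horner-mod f f′ t zero    f≈ = f≈ 0 z≤n
horner-mod {p} f f′ t (suc s) f≈ = subst (p ∣_) (lemma t (horner f t s) (horner f′ t s) (f (suc s)) (f′ (suc s)))
  (∣m∣n⇒∣m+n (∣n⇒∣m*n t (horner-mod f f′ t s (λ j j≤s → f≈ j (ℕₚ.m≤n⇒m≤1+n j≤s)))) (f≈ (suc s) ℕₚ.≤-refl))
  where
  lemma : ∀ t a b c d → t * (a - b) + (c - d) ≡ t * a + c - (t * b + d)
  lemma = solve-∀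

multiple-below : ∀ {p} n → + p ∣ + n → n < p → n ≡ 0
multiple-below zero    _   _   = refl
multiple-below (suc n) p∣n n<p = ⊥-elim (ℕₚ.<⇒≱ n<p (ℕ∣.∣⇒≤ (∣⇒∣ᵤ p∣n)))

-- By `newton`, (j+1) e_(j+1) is determined by the power sums up to j+1 and the e_i with i ≤ j. The
-- factor j+1 can be cancelled since 0 < j+1 ≤ k < p. The conclusion ranges over all i ≤ j to make
-- the induction a strong one.
elem-mod : ∀ {p} k xs ys → Prime p → k < p →
           (∀ i → i < k → + p ∣ powerSum xs (suc i) - powerSum ys (suc i)) →
           ∀ j → j ≤ k → ∀ i → i ≤ j → + p ∣ elem xs i - elem ys i
elem-mod k xs ys pr k<p sums zero    j≤k .0 z≤n =
  subst (_ ∣_) (sym (cong₂ _-_ (elem-zero xs) (elem-zero ys))) (divides 0ℤ refl)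
  where
  elem-zero : ∀ xs → elem xs 0 ≡ 1ℤ
  elem-zero []       = refl
  elem-zero (x ∷ xs) = cong₂ (λ s t → s - t) (elem-zero xs) (ℤₚ.*-zeroʳ (+ x))
elem-mod {p} k xs ys pr k<p sums (suc j) j<k i i≤ with ℕₚ.m≤n⇒m<n∨m≡n i≤
... | inj₁ (s≤s i≤j) = elem-mod k xs ys pr k<p sums j (ℕₚ.<⇒≤ j<k) i i≤j
... | inj₂ refl      = prime-cancel (+ suc j) (elem xs (suc j) - elem ys (suc j)) pr
  (λ d → ℕₚ.1+n≢0 (multiple-below (suc j) d (ℕₚ.≤-<-trans j<k k<p)))
  (subst (+ p ∣_) (trans (cong₂ (λ s t → - (s - t)) (newton xs (suc j)) (newton ys (suc j)))
                         (lemma (+ suc j) (elem xs (suc j)) (elem ys (suc j))))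
    (∣m⇒∣-m (conv-mod (λ i → powerSum xs (suc i)) (λ i → powerSum ys (suc i)) (elem xs) (elem ys) (suc j)
      (λ i i<j → sums i (ℕₚ.≤-trans i<j j<k))
      (λ { i (s≤s i≤j) → elem-mod k xs ys pr k<p sums j (ℕₚ.<⇒≤ j<k) i i≤j }))))
  where
  lemma : ∀ c a b → - (- (c * a) - - (c * b)) ≡ c * (a - b)
  lemma = solve-∀

rootProduct-root : ∀ x xs → rootProduct (+ x) (x ∷ xs) ≡ 0ℤ
rootProduct-root x xs = cong (_* rootProduct (+ x) xs) (ℤₚ.+-inverseʳ (+ x))

rootProduct-prime : ∀ {p} t xs → Prime p → p ≢ 1 → + p ∣ rootProduct t xs → ∃ λ x → x ∈ xs × + p ∣ t - + x
rootProduct-prime t []       pr p≢1 d = ⊥-elim (p≢1 (ℕ∣.∣1⇒≡1 (∣⇒∣ᵤ d)))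
rootProduct-prime {p} t (x ∷ xs) pr p≢1 d with + p ∣? t - + x
... | yes p∣t-x = x , here refl , p∣t-x
... | no  p∤t-x with rootProduct-prime t xs pr p≢1 (prime-cancel (t - + x) _ pr p∤t-x d)
...   | y , y∈ , p∣t-y = y , there y∈ , p∣t-y

-- The monic polynomials with roots `x ∷ xs` and `ys` have the same degree and congruent
-- coefficients. The first vanishes at `x`, so `p` divides the value of the second, and hence one of
-- its factors.
powerSums-determine : ∀ {p} k x xs ys → Prime p → p ≢ 1 → k < p →
  length (x ∷ xs) ≡ length ys → length (x ∷ xs) ≤ k →
  (∀ i → i < k → + p ∣ powerSum (x ∷ xs) (suc i) - powerSum ys (suc i)) →
  ∃ λ y → y ∈ ys × + p ∣ + x - + y
powerSums-determine {p} k x xs ys pr p≢1 k<p len len≤k sums = rootProduct-prime (+ x) ys pr p≢1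
  (subst (+ p ∣_) (lemma _) (∣m⇒∣-m (subst (+ p ∣_) (cong₂ _-_ lhs rhs)
    (horner-mod (elem (x ∷ xs)) (elem ys) (+ x) (length (x ∷ xs))
      (λ j j≤ → elem-mod k (x ∷ xs) ys pr k<p sums k ℕₚ.≤-refl j (ℕₚ.≤-trans j≤ len≤k))))))
  where
  lemma : ∀ z → - (0ℤ - z) ≡ z
  lemma = solve-∀
  lhs : horner (elem (x ∷ xs)) (+ x) (length (x ∷ xs)) ≡ 0ℤ
  lhs = trans (sym (rootProduct≡horner (+ x) (x ∷ xs))) (rootProduct-root x xs)
  rhs : horner (elem ys) (+ x) (length (x ∷ xs)) ≡ rootProduct (+ x) ys
  rhs = trans (cong (horner (elem ys) (+ x)) len) (sym (rootProduct≡horner (+ x) ys))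

-- Integer vectors as pairs of multisets of indices

posPart negPart : ℤ → ℕ
posPart (+ n)      = n
posPart -[1+ n ]   = 0
negPart (+ n)      = 0
negPart -[1+ n ]   = suc n

-- Each index, counted from `c`, is repeated as often as the chosen part of its coordinate says;
-- `posPart` and `negPart` give the two multisets whose power sums are compared.
points : ∀ {N} → (ℤ → ℕ) → ℕ → Vec ℤ N → List ℕ
points part c []       = []
points part c (v ∷ vs) = List.replicate (part v) c ++ points part (suc c) vs

-- With 0^0 = 1, exponent 0 gives the all-ones vector even when the indices start at 0.
powers : ∀ N → ℕ → ℕ → Vec ℤ N
powers zero    c i = []
powers (suc N) c i = (+ c) ^ i ∷ powers N (suc c) i

powerSum-replicate : ∀ n c xs i → powerSum (List.replicate n c ++ xs) i ≡ + n * (+ c) ^ i + powerSum xs i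
powerSum-replicate zero    c xs i = sym (trans (cong (_+ powerSum xs i) (ℤₚ.*-zeroˡ ((+ c) ^ i))) (ℤₚ.+-identityˡ _))
powerSum-replicate (suc n) c xs i = trans (cong (_+_ ((+ c) ^ i)) (powerSum-replicate n c xs i)) (lemma (+ n) ((+ c) ^ i) _)
  where
  lemma : ∀ n x s → x + (n * x + s) ≡ (1ℤ + n) * x + s
  lemma = solve-∀

pos-neg : ∀ v → + posPart v - + negPart v ≡ v
pos-neg (+ n)    = ℤₚ.+-identityʳ (+ n)
pos-neg -[1+ n ] = refl

powerSum-points : ∀ {N} c (v : Vec ℤ N) i →
                  powerSum (points posPart c v) i - powerSum (points negPart c v) i ≡ dot (powers N c i) v
powerSum-points c []       i = refl
powerSum-points {suc N} c (v ∷ vs) i = begin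
  powerSum (points posPart c (v ∷ vs)) i - powerSum (points negPart c (v ∷ vs)) i
    ≡⟨ cong₂ _-_ (powerSum-replicate (posPart v) c _ i) (powerSum-replicate (negPart v) c _ i) ⟩
  + posPart v * (+ c) ^ i + powerSum (points posPart (suc c) vs) i - (+ negPart v * (+ c) ^ i + powerSum (points negPart (suc c) vs) i)
    ≡⟨ lemma (+ posPart v) (+ negPart v) ((+ c) ^ i) _ _ ⟩
  (+ c) ^ i * (+ posPart v - + negPart v) + (powerSum (points posPart (suc c) vs) i - powerSum (points negPart (suc c) vs) i)
    ≡⟨ cong₂ (λ s t → (+ c) ^ i * s + t) (pos-neg v) (powerSum-points (suc c) vs i) ⟩
  (+ c) ^ i * v + dot (powers N (suc c) i) vs ∎
  where
  lemma : ∀ a b x s t → a * x + s - (b * x + t) ≡ x * (a - b) + (s - t)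
  lemma = solve-∀

powerSum-zero : ∀ xs → powerSum xs 0 ≡ + length xs
powerSum-zero []       = refl
powerSum-zero (x ∷ xs) = cong (_+_ 1ℤ) (powerSum-zero xs)

∈-replicate : ∀ {x c : ℕ} n → x ∈ List.replicate n c → x ≡ c × 1 ≤ n
∈-replicate (suc n) (here refl) = refl , s≤s z≤n
∈-replicate (suc n) (there x∈)  = proj₁ (∈-replicate n x∈) , s≤s z≤n

points-range : ∀ {N} part c (v : Vec ℤ N) {x} → x ∈ points part c v → c ≤ x × x < c ℕ.+ N
points-range {suc N} part c (v ∷ vs) x∈ with ∈-++⁻ (List.replicate (part v) c) x∈
... | inj₁ x∈rep with ∈-replicate (part v) x∈rep
...   | refl , _ = ℕₚ.≤-refl , ℕₚ.m<m+n c (s≤s z≤n)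
points-range {suc N} part c (v ∷ vs) {x} x∈ | inj₂ x∈tail with points-range part (suc c) vs x∈tail
... | c<x , x< = ℕₚ.<⇒≤ c<x , subst (x <_) (sym (ℕₚ.+-suc c N)) x<

points-disjoint : ∀ {N} c (v : Vec ℤ N) {x} → x ∈ points posPart c v → x ∈ points negPart c v → ⊥
points-disjoint c (v ∷ vs) x∈ x∈′ with ∈-++⁻ (List.replicate (posPart v) c) x∈ | ∈-++⁻ (List.replicate (negPart v) c) x∈′
... | inj₂ t  | inj₂ t′ = points-disjoint (suc c) vs t t′
points-disjoint c (v ∷ vs) _ _ | inj₁ r | inj₂ t′ with ∈-replicate (posPart v) r
... | refl , _ = ℕₚ.<-irrefl refl (proj₁ (points-range negPart (suc c) vs t′))
points-disjoint c (v ∷ vs) _ _ | inj₂ t | inj₁ r′ with ∈-replicate (negPart v) r′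
... | refl , _ = ℕₚ.<-irrefl refl (proj₁ (points-range posPart (suc c) vs t))
points-disjoint c (+ n      ∷ vs) _ _ | inj₁ r | inj₁ ()
points-disjoint c (-[1+ n ] ∷ vs) _ _ | inj₁ () | inj₁ r′

points-empty : ∀ {N} c (v : Vec ℤ N) → length (points posPart c v) ≡ 0 → length (points negPart c v) ≡ 0 → v ≡ replicate N 0ℤ
points-empty c []             p q = refl
points-empty c (+ zero ∷ vs)  p q = cong (0ℤ ∷_) (points-empty (suc c) vs p q)

length-replicate-++ : ∀ n (c : ℕ) xs → length (List.replicate n c ++ xs) ≡ n ℕ.+ length xs
length-replicate-++ zero    c xs = refl
length-replicate-++ (suc n) c xs = cong suc (length-replicate-++ n c xs)

parts≤square : ∀ v → + (posPart v ℕ.+ negPart v) ℤ.≤ v * v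
parts≤square (+ zero)   = ℤₚ.≤-refl
parts≤square (+ suc n)  = +≤+ (subst (ℕ._≤ suc n ℕ.* suc n) (sym (ℕₚ.+-identityʳ (suc n))) (ℕₚ.m≤m*n (suc n) (suc n)))
parts≤square -[1+ n ]   = +≤+ (ℕₚ.m≤m*n (suc n) (suc n))

-- The two lists together have as many entries as the sum of the absolute values of the coordinates,
-- and |z| ≤ z² for integers.
points≤norm : ∀ {N} c (v : Vec ℤ N) → + (length (points posPart c v) ℕ.+ length (points negPart c v)) ℤ.≤ dot v v
points≤norm c []       = ℤₚ.≤-refl
points≤norm c (v ∷ vs) = subst (ℤ._≤ dot (v ∷ vs) (v ∷ vs)) (sym eq) (ℤₚ.+-mono-≤ (parts≤square v) (points≤norm (suc c) vs))
  where
  P = length (points posPart (suc c) vs)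
  Q = length (points negPart (suc c) vs)
  lemma : ∀ a b s t → a + s + (b + t) ≡ (a + b) + (s + t)
  lemma = solve-∀
  eq : + (length (points posPart c (v ∷ vs)) ℕ.+ length (points negPart c (v ∷ vs))) ≡ + (posPart v ℕ.+ negPart v) + + (P ℕ.+ Q)
  eq = trans (cong +_ (cong₂ ℕ._+_ (length-replicate-++ (posPart v) c _) (length-replicate-++ (negPart v) c _)))
             (lemma (+ posPart v) (+ negPart v) (+ P) (+ Q))

close-multiple : ∀ {p} x y → x < p → y < p → + p ∣ + x - + y → x ≡ y
close-multiple {p} x y x<p y<p d with ℕₚ.≤-total y x
... | inj₁ y≤x = ℕₚ.≤-antisym (ℕₚ.m∸n≡0⇒m≤n (multiple-below (x ℕ.∸ y)
        (subst (+ p ∣_) (trans (ℤₚ.m-n≡m⊖n x y) (ℤₚ.⊖-≥ y≤x)) d) (ℕₚ.≤-<-trans (ℕₚ.m∸n≤m x y) x<p))) y≤x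
... | inj₂ x≤y = ℕₚ.≤-antisym x≤y (ℕₚ.m∸n≡0⇒m≤n (multiple-below (y ℕ.∸ x)
        (subst (+ p ∣_) (trans (lemma (+ x) (+ y)) (trans (ℤₚ.m-n≡m⊖n y x) (ℤₚ.⊖-≥ x≤y))) (∣m⇒∣-m d))
        (ℕₚ.≤-<-trans (ℕₚ.m∸n≤m y x) y<p)))
  where
  lemma : ∀ x y → - (x - y) ≡ y - x
  lemma = solve-∀

-- With s the common size of the multisets, 2s ≤ |v|² < 2(k+1).
few-points : ∀ {N} k (v : Vec ℤ N) → length (points posPart 0 v) ≡ length (points negPart 0 v) →
             dot v v ℤ.< + (2 ℕ.* suc k) → length (points posPart 0 v) ≤ k
few-points k v same-length small = ℕₚ.≤-pred (ℕₚ.*-cancelˡ-< 2 s (suc k) (subst (_< 2 ℕ.* suc k) double 2s<))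
  where
  s : ℕ
  s = length (points posPart 0 v)
  2s< : s ℕ.+ length (points negPart 0 v) < 2 ℕ.* suc k
  2s< = ℤₚ.drop‿+<+ (ℤₚ.≤-<-trans (points≤norm 0 v) small)
  double : s ℕ.+ length (points negPart 0 v) ≡ 2 ℕ.* s
  double = cong (s ℕ.+_) (trans (sym same-length) (sym (ℕₚ.+-identityʳ s)))

points-same-length : ∀ {N} (v : Vec ℤ N) → dot (powers N 0 0) v ≡ 0ℤ →
                     length (points posPart 0 v) ≡ length (points negPart 0 v)
points-same-length v sum≡0 = ℤₚ.+-injective (ℤₚ.i-j≡0⇒i≡j (+ length xs) (+ length ys)
  (trans (sym (cong₂ _-_ (powerSum-zero xs) (powerSum-zero ys))) (trans (powerSum-points 0 v 0) sum≡0)))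
  where
  xs ys : List ℕ
  xs = points posPart 0 v
  ys = points negPart 0 v

points-no-match : ∀ {p N} (v : Vec ℤ N) → N ≤ p → ∀ {x y} → x ∈ points posPart 0 v → y ∈ points negPart 0 v →
                  ¬ (+ p ∣ + x - + y)
points-no-match v N≤p {x} {y} x∈ y∈ p∣x-y = points-disjoint 0 v x∈ (subst (_∈ points negPart 0 v) (sym x≡y) y∈)
  where
  x≡y : x ≡ y
  x≡y = close-multiple x y (ℕₚ.<-≤-trans (proj₂ (points-range posPart 0 v x∈)) N≤p)
                           (ℕₚ.<-≤-trans (proj₂ (points-range negPart 0 v y∈)) N≤p) p∣x-y

craig-minimum : ∀ {p N} k (v : Vec ℤ N) → Prime p → p ≢ 1 → N ≤ p → k < p →
  dot (powers N 0 0) v ≡ 0ℤ → (∀ i → i < k → + p ∣ dot (powers N 0 (suc i)) v) →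
  v ≢ replicate N 0ℤ → + (2 ℕ.* suc k) ℤ.≤ dot v v
craig-minimum {p} {N} k v pr p≢1 N≤p k<p sum≡0 sums v≢0 = ℤₚ.≮⇒≥ (λ small →
    go (points posPart 0 v) refl (few-points k v same-length small))
  where
  ys : List ℕ
  ys = points negPart 0 v
  same-length : length (points posPart 0 v) ≡ length ys
  same-length = points-same-length v sum≡0
  same-sums : ∀ i → i < k → + p ∣ powerSum (points posPart 0 v) (suc i) - powerSum ys (suc i)
  same-sums i i<k = subst (+ p ∣_) (sym (powerSum-points 0 v (suc i))) (sums i i<k)
  go : ∀ xs → points posPart 0 v ≡ xs → length (points posPart 0 v) ≤ k → ⊥
  -- Having the same size, both multisets are empty, so all coordinates are zero.
  go []       eq _   = v≢0 (points-empty 0 v (cong length eq) (trans (sym same-length) (cong length eq)))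
  -- A positive index is congruent to a negative one; both are below `N ≤ p`, hence equal, against
  -- disjointness.
  go (x ∷ xs) eq s≤k = points-no-match v N≤p (subst (x ∈_) (sym eq) (here refl)) (proj₁ (proj₂ match)) (proj₂ (proj₂ match))
    where
    match : ∃ λ y → y ∈ ys × + p ∣ + x - + y
    match = powerSums-determine k x xs ys pr p≢1 k<p
      (trans (cong length (sym eq)) same-length)
      (subst (λ zs → length zs ≤ k) eq s≤k)
      (λ i i<k → subst (λ zs → + p ∣ powerSum zs (suc i) - powerSum ys (suc i)) eq (same-sums i i<k))

-- Parity checks of binary codes

infixr 6 _⊕_

_⊕_ : ∀ {N} → Vec Bool N → Vec Bool N → Vec Bool N
_⊕_ = zipWith _xor_

xorSum : ∀ {N} → Vec Bool N → Bool
xorSum []      = false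
xorSum (x ∷ v) = x xor xorSum v

bdot : ∀ {N} → Vec Bool N → Vec Bool N → Bool
bdot []      []      = false
bdot (x ∷ u) (y ∷ v) = (x ∧ y) xor bdot u v

Even⇒xorSum : ∀ {N} (v : Vec Bool N) → Even (weight v) → xorSum v ≡ false
Even⇒xorSum v e = trans (xorSum-weight v) (even e)
  where
  odd : ℕ → Bool
  odd zero    = false
  odd (suc n) = not (odd n)
  xorSum-weight : ∀ {N} (v : Vec Bool N) → xorSum v ≡ odd (weight v)
  xorSum-weight []          = refl
  xorSum-weight (true  ∷ v) = cong not (xorSum-weight v)
  xorSum-weight (false ∷ v) = xorSum-weight v
  even : ∀ {n} → Even n → odd n ≡ false
  even even0      = refl
  even (even+2 e) = cong (λ b → not (not b)) (even e)

xorSum-⊕ : ∀ {N} (u v : Vec Bool N) → xorSum (u ⊕ v) ≡ xorSum u xor xorSum v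
xorSum-⊕ []      []      = refl
xorSum-⊕ (x ∷ u) (y ∷ v) = trans (cong ((x xor y) xor_) (xorSum-⊕ u v))
  (solve 4 (λ x y s t → (x :+ y) :+ (s :+ t) := (x :+ s) :+ (y :+ t)) refl x y (xorSum u) (xorSum v))

bdot-⊕ : ∀ {N} (h : Vec Bool N) a g w → bdot h (map (a ∧_) g ⊕ w) ≡ (bdot h g ∧ a) xor bdot h w
bdot-⊕ []      a []      []      = refl
bdot-⊕ (x ∷ h) a (y ∷ g) (z ∷ w) = trans (cong ((x ∧ ((a ∧ y) xor z)) xor_) (bdot-⊕ h a g w))
  (solve 6 (λ x a y z s t → (x :* ((a :* y) :+ z)) :+ ((s :* a) :+ t) := (((x :* y) :+ s) :* a) :+ ((x :* z) :+ t))
    refl x a y z (bdot h g) (bdot h w))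

bdot-zeroˡ : ∀ {N} (v : Vec Bool N) → bdot zeroWord v ≡ false
bdot-zeroˡ []      = refl
bdot-zeroˡ (x ∷ v) = bdot-zeroˡ v

⊕-cancelˡ : ∀ {N} (u v : Vec Bool N) → u ⊕ (u ⊕ v) ≡ v
⊕-cancelˡ []          []      = refl
⊕-cancelˡ (true  ∷ u) (true  ∷ v) = cong (true  ∷_) (⊕-cancelˡ u v)
⊕-cancelˡ (true  ∷ u) (false ∷ v) = cong (false ∷_) (⊕-cancelˡ u v)
⊕-cancelˡ (false ∷ u) (y     ∷ v) = cong (y     ∷_) (⊕-cancelˡ u v)

⊕-exchange : ∀ {N} (u v w : Vec Bool N) → u ⊕ (v ⊕ w) ≡ v ⊕ (u ⊕ w)
⊕-exchange []      []      []      = refl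
⊕-exchange (x ∷ u) (y ∷ v) (z ∷ w) = cong₂ _∷_
  (solve 3 (λ x y z → x :+ (y :+ z) := y :+ (x :+ z)) refl x y z) (⊕-exchange u v w)

false-⊕ : ∀ {N} (u v : Vec Bool N) → map (false ∧_) u ⊕ v ≡ v
false-⊕ []      []      = refl
false-⊕ (x ∷ u) (y ∷ v) = cong (y ∷_) (false-⊕ u v)

-- Elimination of the first coordinate by adding the pivot row `true ∷ t` to words that begin with
-- `true`.
clear : ∀ {N} → Vec Bool N → Vec Bool (suc N) → Vec Bool N
clear t (h ∷ r) = map (h ∧_) t ⊕ r

clear-⊕ : ∀ {N} (t : Vec Bool N) c x y → map (c ∧_) (clear t x) ⊕ clear t y ≡ clear t (map (c ∧_) x ⊕ y)
clear-⊕ t c (h ∷ r) (k ∷ s) = go t r s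
  where
  go : ∀ {N} (t r s : Vec Bool N) → map (c ∧_) (map (h ∧_) t ⊕ r) ⊕ (map (k ∧_) t ⊕ s)
       ≡ map (((c ∧ h) xor k) ∧_) t ⊕ (map (c ∧_) r ⊕ s)
  go []      []      []      = refl
  go (x ∷ t) (y ∷ r) (z ∷ s) = cong₂ _∷_
    (solve 6 (λ c h k x y z → (c :* ((h :* x) :+ y)) :+ ((k :* x) :+ z) := (((c :* h) :+ k) :* x) :+ ((c :* y) :+ z))
      refl c h k x y z) (go t r s)

clear-zero : ∀ {N} (t : Vec Bool N) → zeroWord ≡ clear t zeroWord
clear-zero t = sym (false-⊕ t zeroWord)

combine-clear : ∀ {N k} (t : Vec Bool N) (G : Vec (Vec Bool (suc N)) k) c →
                combine (map (clear t) G) c ≡ clear t (combine G c)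
combine-clear t []      []       = clear-zero t
combine-clear t (g ∷ G) (c ∷ cs) = trans (cong (map (c ∧_) (clear t g) ⊕_) (combine-clear t G cs)) (clear-⊕ t c g (combine G cs))

-- One step of Gaussian elimination, recorded by its effect on codewords. In `pivot`, `T c a` gives
-- coefficients over `G` for the codeword assembled from a leading bit `a` and a word of `G′`; the
-- last field carries independence over to `G′`.
data FirstColumn {N} : ∀ {k} → Vec (Vec Bool (suc N)) k → Set where
  null  : ∀ {k} {G : Vec (Vec Bool (suc N)) k} (G′ : Vec (Vec Bool N) k) →
          (∀ c → combine G c ≡ false ∷ combine G′ c) → FirstColumn G
  pivot : ∀ {k} {G : Vec (Vec Bool (suc N)) (suc k)} (g : Vec Bool N) (G′ : Vec (Vec Bool N) k)
          (T : Vec Bool k → Bool → Vec Bool (suc k)) →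
          (∀ c a → combine G (T c a) ≡ a ∷ (map (a ∧_) g ⊕ combine G′ c)) →
          (∀ c → T c false ≡ zeroWord → c ≡ zeroWord) → FirstColumn G

firstColumn : ∀ {N k} (G : Vec (Vec Bool (suc N)) k) → FirstColumn G
firstColumn []                 = null [] λ where [] → refl
firstColumn {N} {suc k} ((true ∷ t) ∷ G) = pivot t (map (clear t) G) T eq (λ c → Vecₚ.∷-injectiveʳ)
  where
  head : ∀ {N} → Vec Bool (suc N) → Bool
  head (x ∷ _) = x
  T : Vec Bool k → Bool → Vec Bool (suc k)
  -- The pivot coefficient corrects the leading bit of `combine G c` to `a`.
  T c a = (a xor head (combine G c)) ∷ c
  add : ∀ {N} a (t : Vec Bool N) w →
        map ((a xor head w) ∧_) (true ∷ t) ⊕ w ≡ a ∷ (map (a ∧_) t ⊕ clear t w)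
  add a t (s ∷ u) = cong₂ _∷_ (bit a s) (go t u)
    where
    bit : ∀ a s → ((a xor s) ∧ true) xor s ≡ a
    bit true  true  = refl
    bit true  false = refl
    bit false true  = refl
    bit false false = refl
    go : ∀ {N} (t u : Vec Bool N) → map ((a xor s) ∧_) t ⊕ u ≡ map (a ∧_) t ⊕ (map (s ∧_) t ⊕ u)
    go []      []      = refl
    go (x ∷ t) (y ∷ u) = cong₂ _∷_
      (solve 4 (λ a s x y → ((a :+ s) :* x) :+ y := (a :* x) :+ ((s :* x) :+ y)) refl a s x y) (go t u)
  eq : ∀ c a → combine ((true ∷ t) ∷ G) (T c a) ≡ a ∷ (map (a ∧_) t ⊕ combine (map (clear t) G) c)
  eq c a = trans (add a t (combine G c)) (cong (λ w → a ∷ (map (a ∧_) t ⊕ w)) (sym (combine-clear t G c)))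
firstColumn ((false ∷ t) ∷ G) with firstColumn G
... | null G′ eq = null (t ∷ G′) λ where
      (c ∷ cs) → trans (cong (map (c ∧_) (false ∷ t) ⊕_) (eq cs))
        (cong (λ b → (b xor false) ∷ (map (c ∧_) t ⊕ combine G′ cs)) (∧-zeroʳ c))
... | pivot g G′ T eq zeros = pivot g (t ∷ G′) (λ { (c ∷ cs) a → c ∷ T cs a })
      (λ { (c ∷ cs) a → trans (cong (map (c ∧_) (false ∷ t) ⊕_) (eq cs a))
             (cong₂ _∷_ (cong (_xor a) (∧-zeroʳ c)) (⊕-exchange (map (c ∧_) t) (map (a ∧_) g) (combine G′ cs))) })
      (λ { (c ∷ cs) e → cong₂ _∷_ (Vecₚ.∷-injectiveˡ e) (zeros cs (Vecₚ.∷-injectiveʳ e)) })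

Independent : ∀ {N k} → Vec (Vec Bool N) k → Set
Independent G = ∀ c → combine G c ≡ zeroWord → c ≡ zeroWord

-- Words have length `suc N`, so `dimension` counts one check fewer than the codimension; the
-- condition on `xorSum` in `complete` is the remaining check.
record ParityChecks {N k} (G : Vec (Vec Bool (suc N)) k) : Set where
  field
    redundancy : ℕ
    dimension  : redundancy ℕ.+ k ≡ N
    checks     : Vec (Vec Bool (suc N)) redundancy
    complete   : ∀ v → xorSum v ≡ false → All (λ h → bdot h v ≡ false) checks → ∃ λ c → combine G c ≡ v

-- Recursion on the length. A null column costs one check, that the first bit is zero. A pivot costs
-- none: each check `h` of `G′` gets the leading bit `bdot h g`, so its value at `a ∷ w` is that of
-- `h` at w + a g, which is the word to be recognised in `G′`.
parityChecks : ∀ {N k} (G : Vec (Vec Bool (suc N)) k) → Independent G → (∀ c → xorSum (combine G c) ≡ false) → ParityChecks G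
parityChecks {zero} [] ind even = record
  { redundancy = 0 ; dimension = refl ; checks = [] ; complete = λ { (false ∷ []) _ _ → [] , refl } }
-- An even word of length one is zero, so no row can be independent.
parityChecks {zero} {suc k} G ind even = ⊥-elim (false≢true (Vecₚ.∷-injectiveˡ (ind c (zero-word _ (even c)))))
  where
  c : Vec Bool (suc k)
  c = true ∷ zeroWord
  false≢true : true ≡ false → ⊥
  false≢true ()
  zero-word : (v : Vec Bool 1) → xorSum v ≡ false → v ≡ zeroWord
  zero-word (false ∷ []) _ = refl
parityChecks {suc N} {k} G ind even with firstColumn G
... | null G′ eq = record
  { redundancy = suc C.redundancy ; dimension = cong suc C.dimension
  ; checks = (true ∷ zeroWord) ∷ map (false ∷_) C.checks ; complete = complete′ }
  where
  C = parityChecks G′ (λ c e → ind c (trans (eq c) (cong (false ∷_) e))) (λ c → trans (cong xorSum (sym (eq c))) (even c))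
  module C = ParityChecks C
  complete′ : ∀ v → xorSum v ≡ false → All (λ h → bdot h v ≡ false) ((true ∷ zeroWord) ∷ map (false ∷_) C.checks) →
              ∃ λ c → combine G c ≡ v
  complete′ (true  ∷ w) e (h ∷ hs) with trans (cong not (sym (bdot-zeroˡ w))) h
  ... | ()
  complete′ (false ∷ w) e (h ∷ hs) with C.complete w e (map⁻ hs)
  ... | c , refl = c , eq c
parityChecks {suc N} {suc k} G ind even | pivot g G′ T eq zeros = record
  { redundancy = C.redundancy ; dimension = trans (ℕₚ.+-suc C.redundancy k) (cong suc C.dimension)
  ; checks = map (λ h → bdot h g ∷ h) C.checks ; complete = complete′ }
  where
  even′ : ∀ c → xorSum (combine G′ c) ≡ false
  even′ c = trans (cong xorSum (sym (trans (eq c false) (cong (false ∷_) (false-⊕ g _))))) (even (T c false))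
  ind′ : Independent G′
  ind′ c e = zeros c (ind (T c false) (trans (eq c false) (cong (false ∷_) (trans (false-⊕ g _) e))))
  module C = ParityChecks (parityChecks G′ ind′ even′)
  -- `a ∷ map (a ∧_) g` differs from a codeword of `G` only by the even word `combine G′ zeroWord`.
  even-g : ∀ a → a xor xorSum (map (a ∧_) g) ≡ false
  even-g a = trans (cong (a xor_) (sym (trans (xorSum-⊕ (map (a ∧_) g) _) (trans (cong (xorSum (map (a ∧_) g) xor_) (even′ zeroWord))
      (xor-identityʳ _))))) (trans (cong xorSum (sym (eq zeroWord a))) (even (T zeroWord a)))
  complete′ : ∀ v → xorSum v ≡ false → All (λ h → bdot h v ≡ false) (map (λ h → bdot h g ∷ h) C.checks) →
              ∃ λ c → combine G c ≡ v
  complete′ (a ∷ w) e hs with C.complete (map (a ∧_) g ⊕ w) (trans (xorSum-⊕ (map (a ∧_) g) w) (both a _ _ (even-g a) e))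
                                 (All.map (λ {h} → trans (bdot-⊕ h a g w)) (map⁻ hs))
    where
    both : ∀ a s t → a xor s ≡ false → a xor t ≡ false → s xor t ≡ false
    both true  true  true  _ _ = refl
    both false false false _ _ = refl
  ... | c , e′ = T c a , trans (eq c a) (cong (a ∷_) (trans (cong (map (a ∧_) g ⊕_) e′) (⊕-cancelˡ (map (a ∧_) g) w)))

-- Reduction modulo 2

bit : Bool → ℤ
bit true  = 1ℤ
bit false = 0ℤ

residue-ℕ : ∀ n → ∃ λ b → + 2 ∣ + n - bit b
residue-ℕ zero    = false , divides 0ℤ refl
residue-ℕ (suc n) with residue-ℕ n
... | true  , d = false , subst (+ 2 ∣_) (lemma (+ n)) (∣m∣n⇒∣m+n d (divides 1ℤ refl))
  where
  lemma : ∀ n → n - 1ℤ + + 2 ≡ 1ℤ + n - 0ℤ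
  lemma = solve-∀
... | false , d = true , subst (+ 2 ∣_) (lemma (+ n)) d
  where
  lemma : ∀ n → n - 0ℤ ≡ 1ℤ + n - 1ℤ
  lemma = solve-∀

residue : ∀ z → ∃ λ b → + 2 ∣ z - bit b
residue (+ n)    = residue-ℕ n
residue -[1+ n ] with residue-ℕ (suc n)
... | b , d = b , subst (+ 2 ∣_) (lemma (+ suc n) (bit b)) (∣m⇒∣-m (∣m∣n⇒∣m+n d (divides (bit b) refl)))
  where
  lemma : ∀ z b → - (z - b + b * + 2) ≡ - z - b
  lemma = solve-∀

residue-unique : ∀ z b → + 2 ∣ z → + 2 ∣ z - bit b → b ≡ false
residue-unique z false _ _ = refl
residue-unique z true  d e with multiple-below {2} 1 (subst (+ 2 ∣_) (lemma z) (∣m∣n⇒∣m-n d e)) (s≤s (s≤s z≤n))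
  where
  lemma : ∀ z → z - (z - 1ℤ) ≡ 1ℤ
  lemma = solve-∀
... | ()

bit-xor : ∀ b c → + 2 ∣ bit b + bit c - bit (b xor c)
bit-xor true  true  = divides 1ℤ refl
bit-xor true  false = divides 0ℤ refl
bit-xor false true  = divides 0ℤ refl
bit-xor false false = divides 0ℤ refl

bit-∧ : ∀ b c → bit b * bit c ≡ bit (b ∧ c)
bit-∧ true  true  = refl
bit-∧ true  false = refl
bit-∧ false true  = refl
bit-∧ false false = refl

reduce : ∀ {N} → Vec ℤ N → Vec Bool N
reduce = map (λ z → proj₁ (residue z))

dot-reduce : ∀ {N} (h : Vec Bool N) v → + 2 ∣ dot (map bit h) v - bit (bdot h (reduce v))
dot-reduce []      []      = divides 0ℤ refl
dot-reduce (x ∷ h) (z ∷ v) = subst (+ 2 ∣_) eq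
  (∣m∣n⇒∣m+n (∣m∣n⇒∣m+n (∣n⇒∣m*n (bit x) (proj₂ (residue z))) (dot-reduce h v)) (bit-xor (x ∧ c) s))
  where
  c s : Bool
  c = proj₁ (residue z)
  s = bdot h (reduce v)
  lemma : ∀ x z c t s u → x * (z - c) + (t - s) + (x * c + s - u) ≡ x * z + t - u
  lemma = solve-∀
  eq : bit x * (z - bit c) + (dot (map bit h) v - bit s) + (bit (x ∧ c) + bit s - bit ((x ∧ c) xor s))
       ≡ bit x * z + dot (map bit h) v - bit ((x ∧ c) xor s)
  eq = trans (cong (λ w → bit x * (z - bit c) + (dot (map bit h) v - bit s) + (w + bit s - bit ((x ∧ c) xor s))) (sym (bit-∧ x c)))
             (lemma (bit x) z (bit c) (dot (map bit h) v) (bit s) (bit ((x ∧ c) xor s)))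

bdot-reduce : ∀ {N} (h : Vec Bool N) v → + 2 ∣ dot (map bit h) v → bdot h (reduce v) ≡ false
bdot-reduce h v d = residue-unique _ _ d (dot-reduce h v)

bdot-ones : ∀ {N} (w : Vec Bool N) → bdot (replicate N true) w ≡ xorSum w
bdot-ones []      = refl
bdot-ones (x ∷ w) = cong (x xor_) (bdot-ones w)

bits-ones : ∀ N → map bit (replicate N true) ≡ replicate N 1ℤ
bits-ones N = Vecₚ.map-replicate bit true N

powers-zero : ∀ N c → powers N c 0 ≡ replicate N 1ℤ
powers-zero zero    c = refl
powers-zero (suc N) c = cong (1ℤ ∷_) (powers-zero N (suc c))

xorSum-reduce : ∀ {N} (v : Vec ℤ N) → dot (replicate N 1ℤ) v ≡ 0ℤ → xorSum (reduce v) ≡ false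
xorSum-reduce {N} v e = trans (sym (bdot-ones (reduce v)))
  (bdot-reduce (replicate N true) v (divides 0ℤ (trans (cong (λ h → dot h v) (bits-ones N)) e)))

odd-square : ∀ z → + 2 ∣ z - 1ℤ → 1ℤ ℤ.≤ z * z
odd-square (+ zero)  d with residue-unique 0ℤ true (divides 0ℤ refl) d
... | ()
odd-square (+ suc n) _ = ℤₚ.≤-trans (+≤+ (s≤s z≤n)) (parts≤square (+ suc n))
odd-square -[1+ n ]  _ = ℤₚ.≤-trans (+≤+ (s≤s z≤n)) (parts≤square -[1+ n ])

-- The weight counts the odd coordinates, each of which has square at least 1.
weight≤norm : ∀ {N} (v : Vec ℤ N) → + weight (reduce v) ℤ.≤ dot v v
weight≤norm []      = ℤₚ.≤-refl
weight≤norm (z ∷ v) with residue z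
... | true  , d = ℤₚ.+-mono-≤ (odd-square z d) (weight≤norm v)
... | false , d = subst (ℤ._≤ z * z + dot v v) (ℤₚ.+-identityˡ _)
                    (ℤₚ.+-mono-≤ (ℤₚ.≤-trans (+≤+ z≤n) (parts≤square z)) (weight≤norm v))

halve-entry : ∀ z → proj₁ (residue z) ≡ false → ∃ λ q → z ≡ + 2 * q
halve-entry z with residue z
... | false , divides q z≡ = λ _ → q , trans (sym (ℤₚ.+-identityʳ z)) (trans z≡ (ℤₚ.*-comm q (+ 2)))
... | true  , _            = λ ()

halve : ∀ {N} (v : Vec ℤ N) → reduce v ≡ zeroWord → ∃ λ y → v ≡ map (+ 2 *_) y
halve []      _ = [] , refl
halve (z ∷ v) e with halve-entry z (Vecₚ.∷-injectiveˡ e) | halve v (Vecₚ.∷-injectiveʳ e)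
... | q , z≡ | y , v≡ = q ∷ y , cong₂ _∷_ z≡ v≡

-- Scaling by two and the minimum norm of the lattice

dot-scaleʳ : ∀ {N} (h : Vec ℤ N) c y → dot h (map (c *_) y) ≡ c * dot h y
dot-scaleʳ []      c []      = sym (ℤₚ.*-zeroʳ c)
dot-scaleʳ (x ∷ h) c (z ∷ y) = trans (cong (_+_ (x * (c * z))) (dot-scaleʳ h c y)) (lemma x c z (dot h y))
  where
  lemma : ∀ x c z s → x * (c * z) + c * s ≡ c * (x * z + s)
  lemma = solve-∀

norm-scale : ∀ {N} c (y : Vec ℤ N) → dot (map (c *_) y) (map (c *_) y) ≡ c * (c * dot y y)
norm-scale c y = trans (dot-scaleʳ (map (c *_) y) c y)
  (cong (c *_) (trans (dot-comm (map (c *_) y) y) (dot-scaleʳ y c y)))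

-- The exponents run from 1 to `μ`, to be taken as m - 1; exponent 0 is the zero-sum condition of
-- the root lattice.
powerRows : ∀ N μ → Vec (Vec ℤ N) μ
powerRows N μ = tabulate (λ i → powers N 0 (suc (toℕ i)))

powerRows-divides : ∀ {N μ p} v → All (λ h → + p ∣ dot h v) (powerRows N μ) →
                    ∀ i → i < μ → + p ∣ dot (powers N 0 (suc i)) v
powerRows-divides {N} {μ} {p} v all i i<μ =
  subst (λ j → + p ∣ dot (powers N 0 (suc j)) v) (Finₚ.toℕ-fromℕ< i<μ) (tabulate⁻ all (fromℕ< i<μ))

codeCraig-minimum : ∀ {N k μ p} (G : Vec (Vec Bool (suc N)) k) → EvenSubcode (suc N) k (8 ℕ.* suc μ) G →
  Prime p → suc N ≤ p → 2 < p → μ < p → (C : ParityChecks G) → (v : Vec ℤ (suc N)) →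
  dot (replicate (suc N) 1ℤ) v ≡ 0ℤ →
  All (λ h → + p ∣ dot h v) (powerRows (suc N) μ) →
  All (λ h → + 2 ∣ dot h v) (map (map bit) (ParityChecks.checks C)) →
  v ≢ replicate (suc N) 0ℤ → + (8 ℕ.* suc μ) ℤ.≤ dot v v
codeCraig-minimum {N} {k} {μ} {p} G code pr N<p 2<p μ<p C v sum≡0 pdiv 2div v≢0
  with ParityChecks.complete C (reduce v) (xorSum-reduce v sum≡0) (All.map (λ {h} → bdot-reduce h v) (map⁻ 2div))
... | c , eq with Vecₚ.≡-dec Boolₚ._≟_ (combine G c) zeroWord
...   | no  c≢0 = ℤₚ.≤-trans (+≤+ (subst (λ w → 8 ℕ.* suc μ ≤ weight w) eq (EvenSubcode.minDist code c c≢0)))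
                          (weight≤norm v)
...   | yes c≡0 with halve v (trans (sym eq) c≡0)
-- The vector is twice `y`, so the bound 2(μ+1) for `y` is multiplied by 4.
...     | y , refl = subst₂ ℤ._≤_ bound (sym (norm-scale (+ 2) y))
            (ℤₚ.*-monoˡ-≤-nonNeg (+ 2) (ℤₚ.*-monoˡ-≤-nonNeg (+ 2)
              (craig-minimum μ y pr (λ p≡1 → ℕₚ.<⇒≱ 2<p (ℕₚ.≤-trans (ℕₚ.≤-reflexive p≡1) (s≤s z≤n)))
                N<p μ<p sum-y div-y y≢0)))
  where
  bound : + 2 * (+ 2 * + (2 ℕ.* suc μ)) ≡ + (8 ℕ.* suc μ)
  bound = trans (lemma (+ suc μ)) (sym (ℤₚ.pos-* 8 (suc μ)))
    where
    lemma : ∀ z → + 2 * (+ 2 * (z + (z + 0ℤ))) ≡ + 8 * z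
    lemma = solve-∀
  sum-y : dot (powers (suc N) 0 0) y ≡ 0ℤ
  sum-y = trans (cong (λ h → dot h y) (powers-zero (suc N) 0))
    (ℤₚ.*-cancelˡ-≡ (+ 2) _ 0ℤ (trans (sym (dot-scaleʳ (replicate (suc N) 1ℤ) (+ 2) y)) sum≡0))
  div-y : ∀ i → i < μ → + p ∣ dot (powers (suc N) 0 (suc i)) y
  -- The factor 2 can be cancelled because 2 < p keeps `p` from dividing it.
  div-y i i<μ = prime-cancel (+ 2) _ pr (λ d → ℕₚ.1+n≢0 (multiple-below 2 d 2<p))
    (subst (+ p ∣_) (dot-scaleʳ (powers (suc N) 0 (suc i)) (+ 2) y) (powerRows-divides (map (+ 2 *_) y) pdiv i i<μ))
  y≢0 : y ≢ replicate (suc N) 0ℤ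
  y≢0 y≡0 = v≢0 (trans (cong (map (+ 2 *_)) y≡0) (Vecₚ.map-replicate (+ 2 *_) 0ℤ (suc N)))

-- The density bound squared and cleared of denominators: the squared density is (λ²/4)^n / det, the
-- squared bound 2^(2k) m^n / (2^n l^(2(m-1)) (n+1)). Ranging over all nonzero combinations includes
-- the shortest, and the positive Gram determinant makes `B` a basis of a lattice of rank `n`.
theorem2p3 : (n m l k : ℕ) → 1 ≤ n → 1 ≤ m → 2 ℕ.* m < n → suc n ≤ l → Prime l → l % 2 ≡ 1 →
    Σ (Vec (Vec Bool (suc n)) k) (λ G → EvenSubcode (suc n) k (8 ℕ.* m) G) →
    Σ (Vec (Vec ℤ (suc n)) n) (λ B →
    (ℤ.0ℤ ℤ.< det (gram B))
    × ((a : Vec ℤ n) → a ≢ replicate n ℤ.0ℤ →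
    ((+ 2) ^ (2 ℕ.* k)) * ((+ m) ^ n) * ((+ 4) ^ n) * det (gram B)
    ℤ.≤ (dot (latticeVec B a) (latticeVec B a) ^ n) * ((+ l) ^ (2 ℕ.* (m ℕ.∸ 1)))
    * (+ suc n) * ((+ 2) ^ n)))
theorem2p3 n (suc μ) l k 1≤n 1≤m 2m<n n<l pr odd (G , code) = S.basis , det-pos , bound
  where
  m≤2m : suc μ ≤ 2 ℕ.* suc μ
  m≤2m = ℕₚ.m≤m+n (suc μ) (suc μ ℕ.+ 0)
  μ<l : μ < l
  μ<l = ℕₚ.≤-trans m≤2m (ℕₚ.≤-trans (ℕₚ.<⇒≤ 2m<n) (ℕₚ.<⇒≤ n<l))
  2<l : 2 < l
  -- From 2 ≤ 2m < n < l.
  2<l = ℕₚ.<-trans (ℕₚ.≤-<-trans (ℕₚ.*-monoʳ-≤ 2 {1} {suc μ} (s≤s z≤n)) 2m<n) n<l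
  independent : Independent G
  independent c e with Vecₚ.≡-dec Boolₚ._≟_ c zeroWord
  ... | yes c≡0 = c≡0
  ... | no  c≢0 = ⊥-elim (EvenSubcode.independent code c c≢0 e)
  C : ParityChecks G
  C = parityChecks G independent (λ c → Even⇒xorSum (combine G c) (EvenSubcode.evenWeight code c))
  module C = ParityChecks C
  CraigCongruences CodeCongruences : Vec ℤ (suc n) → Set
  CraigCongruences v = All (λ h → + l ∣ dot h v) (powerRows (suc n) μ)
  CodeCongruences v = All (λ h → + 2 ∣ dot h v) (map (map bit) C.checks)
  S : Sublattice (λ v → CraigCongruences v × CodeCongruences v) ((+ 2 * + 2) ^ C.redundancy * (+ l * + l) ^ μ) (rootBasis n)
  S = compose craig (kernels (map (map bit) C.checks) prime[2] (Sublattice.basis craig))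
    where
    craig = kernels (powerRows (suc n) μ) pr (rootBasis n)
  module S = Sublattice S
  det≡ : det (gram S.basis) ≡ S.scale * S.scale * + suc n
  det≡ = trans (det≡gramDet S.basis S.basis)
    (trans (gramDet-sublattice S) (cong (S.scale * S.scale *_) (gramDet-roots n)))
  det-pos : 0ℤ ℤ.< det (gram S.basis)
  det-pos = subst (0ℤ ℤ.<_) (sym det≡) (ℤₚ.*-monoʳ-<-pos (+ suc n) S.scale-pos)
  minimum : ∀ a → a ≢ replicate n 0ℤ → + (8 ℕ.* suc μ) ℤ.≤ dot (latticeVec S.basis a) (latticeVec S.basis a)
  -- The zero coordinate sum and the nonvanishing of the vector are both inherited from the root
  -- lattice through `S.finer`.
  minimum a a≢0 = codeCraig-minimum G code pr n<l 2<l μ<l C (latticeVec S.basis a)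
    (trans (cong (dot (replicate (suc n) 1ℤ)) v≡) (dot-rootBasis n a′)) (proj₁ (S.holds a)) (proj₂ (S.holds a))
    (λ v≡0 → a≢0 (proj₂ (proj₂ (S.finer a)) (rootBasis-independent n a′ (trans (sym v≡) v≡0))))
    where
    a′ : Vec ℤ n
    a′ = proj₁ (S.finer a)
    v≡ : latticeVec S.basis a ≡ latticeVec (rootBasis n) a′
    v≡ = proj₁ (proj₂ (S.finer a))
  bound : ∀ a → a ≢ replicate n 0ℤ →
    (+ 2) ^ (2 ℕ.* k) * (+ suc μ) ^ n * (+ 4) ^ n * det (gram S.basis)
      ℤ.≤ dot (latticeVec S.basis a) (latticeVec S.basis a) ^ n * (+ l) ^ (2 ℕ.* μ) * + suc n * (+ 2) ^ n
  bound a a≢0 = subst (λ d → (+ 2) ^ (2 ℕ.* k) * (+ suc μ) ^ n * (+ 4) ^ n * d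
      ℤ.≤ dot (latticeVec S.basis a) (latticeVec S.basis a) ^ n * (+ l) ^ (2 ℕ.* μ) * + suc n * (+ 2) ^ n) (sym det≡)
    (density-inequality n k C.redundancy μ l (suc μ) (S.scale * S.scale) _ C.dimension S.scale-bound (minimum a a≢0))
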